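{- Let $\mathcal{A}=(\mathcal{H},Act,\{\mathcal{E}_\alpha\}_{\alpha\in Act},\sigma_0)$ be a quantum automaton with rational data, and let $\phi=\bigvee_{i=1}^t p_i$ with each $p_i$ a subspace (projection) of $\mathcal{H}$. Then it is decidable whether $\square\lozenge\phi$ is valid, i.e. whether for every infinite word $\alpha_1\alpha_2\cdots\in Act^\omega$ the induced sequence satisfies $\sigma_i\models\phi$ for infinitely many $i$.
   Context: A quantum automaton consists of a $d$-dimensional Hilbert space $\mathcal{H}$, a finite set $Act$ of actions, a trace-preserving super-operator $\mathcal{E}_\alpha$ on $\mathcal{H}$ for each $\alpha\in Act$, and an initial state $\sigma_0$; all entries are rational. Each word $\alpha_1\alpha_2\cdots\in Act^\omega$ induces the admissible sequence $\sigma_0\sigma_1\cdots$ with $\sigma_i=\mathcal{E}_{\alpha_i}(\sigma_{i-1})$. For a state $\sigma$ and subspace $p$, $\sigma\models p$ iff $\mathrm{supp}(\sigma)\subseteq p$; for a finite union $\phi=\bigvee_i p_i$ of subspaces, $\sigma\models\phi$ iff $\sigma\models p_i$ for some $i$. -}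

module Defs where

open import Data.Nat using (ℕ; zero; suc; _≤_)
open import Data.Fin using (Fin; zero; suc)
open import Data.List using (List; []; _∷_)
open import Data.Product using (Σ; ∃; _×_)
open import Relation.Binary.PropositionalEquality using (_≡_)
open import Data.Rational as Q using (ℚ; 0ℚ; 1ℚ)

-- Gaussian rationals ℚ(i) = {a + b i | a b ∈ ℚ}  ("rational" complex entries)

record ℚi : Set where
  constructor _+i_
  field
    re : ℚ
    im : ℚ
open ℚi public

0ᶜ : ℚi
0ᶜ = 0ℚ +i 0ℚ

1ᶜ : ℚi
1ᶜ = 1ℚ +i 0ℚ

_+ᶜ_ : ℚi → ℚi → ℚi
(a +i b) +ᶜ (c +i d) = (a Q.+ c) +i (b Q.+ d)

_*ᶜ_ : ℚi → ℚi → ℚi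
(a +i b) *ᶜ (c +i d) = ((a Q.* c) Q.- (b Q.* d)) +i ((a Q.* d) Q.+ (b Q.* c))

conj : ℚi → ℚi
conj (a +i b) = a +i (Q.- b)

∑ : ∀ {d} → (Fin d → ℚi) → ℚi
∑ {zero}  f = 0ᶜ
∑ {suc d} f = f zero +ᶜ ∑ (λ i → f (suc i))

-- Operators on the d-dimensional Hilbert space H = ℂ^d (with rational entries)

Vector : ℕ → Set
Vector d = Fin d → ℚi

Matrix : ℕ → Set
Matrix d = Fin d → Fin d → ℚi

_·_ : ∀ {d} → Matrix d → Matrix d → Matrix d
(A · B) i j = ∑ (λ k → A i k *ᶜ B k j)

_▷_ : ∀ {d} → Matrix d → Vector d → Vector d
(A ▷ x) i = ∑ (λ k → A i k *ᶜ x k)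

_† : ∀ {d} → Matrix d → Matrix d
(A †) i j = conj (A j i)

_⊕_ : ∀ {d} → Matrix d → Matrix d → Matrix d
(A ⊕ B) i j = A i j +ᶜ B i j

𝟘 : ∀ {d} → Matrix d
𝟘 i j = 0ᶜ

𝕀 : ∀ {d} → Matrix d
𝕀 {suc d} zero    zero    = 1ᶜ
𝕀 {suc d} zero    (suc j) = 0ᶜ
𝕀 {suc d} (suc i) zero    = 0ᶜ
𝕀 {suc d} (suc i) (suc j) = 𝕀 {d} i j

trace : ∀ {d} → Matrix d → ℚi
trace A = ∑ (λ i → A i i)

_≐_ : ∀ {d} → Matrix d → Matrix d → Set
A ≐ B = ∀ i j → A i j ≡ B i j

⟨_,_⟩ : ∀ {d} → Vector d → Vector d → ℚi
⟨ x , y ⟩ = ∑ (λ k → conj (x k) *ᶜ y k)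

IsHermitian : ∀ {d} → Matrix d → Set
IsHermitian A = A ≐ (A †)

IsPositive : ∀ {d} → Matrix d → Set
IsPositive A = IsHermitian A × (∀ x → 0ℚ Q.≤ re ⟨ x , A ▷ x ⟩)

IsDensity : ∀ {d} → Matrix d → Set
IsDensity ρ = IsPositive ρ × (trace ρ ≡ 1ᶜ)

-- orthogonal projection (identified with the subspace it projects onto)
IsProjection : ∀ {d} → Matrix d → Set
IsProjection P = IsHermitian P × ((P · P) ≐ P)

-- Super-operators in Kraus form: E(ρ) = Σ_k E_k ρ E_k†

Kraus : ℕ → Set
Kraus d = List (Matrix d)

apply : ∀ {d} → Kraus d → Matrix d → Matrix d
apply []       ρ = 𝟘
apply (E ∷ Es) ρ = ((E · ρ) · (E †)) ⊕ apply Es ρ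

krausSum : ∀ {d} → Kraus d → Matrix d
krausSum []       = 𝟘
krausSum (E ∷ Es) = ((E †) · E) ⊕ krausSum Es

IsTracePreserving : ∀ {d} → Kraus d → Set
IsTracePreserving Es = krausSum Es ≐ 𝕀

record QAutomaton (d n : ℕ) : Set where
  field
    ops    : Fin n → Kraus d
    tp     : ∀ α → IsTracePreserving (ops α)
    σ₀     : Matrix d
    σ₀-den : IsDensity σ₀
open QAutomaton public

-- admissible sequence induced by the word w = α₁α₂⋯ (α_{i+1} = w i)
run : ∀ {d n} → QAutomaton d n → (ℕ → Fin n) → ℕ → Matrix d
run A w zero    = σ₀ A
run A w (suc i) = apply (ops A (w i)) (run A w i)

-- range of σ ⊆ range of P (i.e. supp σ ⊆ p):
-- every vector σ x of the range of σ lies in the subspace p, i.e. P (σ x) = σ x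
_⊨_ : ∀ {d} → Matrix d → Matrix d → Set
σ ⊨ P = ∀ x i → (P ▷ (σ ▷ x)) i ≡ (σ ▷ x) i

_⊨∨_ : ∀ {d t} → Matrix d → (Fin t → Matrix d) → Set
σ ⊨∨ ps = ∃ λ i → σ ⊨ ps i

ValidAlwaysEventually : ∀ {d n t} → QAutomaton d n → (Fin t → Matrix d) → Set
ValidAlwaysEventually A ps =
  ∀ (w : ℕ → Fin _) (N : ℕ) → ∃ λ i → N ≤ i × (run A w i ⊨∨ ps)

{-# OPTIONS --safe #-}
module Submission where

-- Clearing denominators, the automaton becomes a family of ℤ-linear maps on ℤ^D, and σ ⊨ p a system of linear
-- equations on the vector of σ. Call a vector valid if every word from it meets the union φ of the given
-- subspaces infinitely often. The set of valid vectors is a finite union of subspaces, and is computed from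
-- above, starting from the whole space and keeping a finite list of subspaces that covers it.
--
-- If the image of a member W under an action lies in no member, W can be cut down to finitely many proper
-- subspaces. If the list is invariant and some member W escapes φ along a word longer than an explicit bound,
-- then by pigeonhole and induction on dimension some member W escapes φ, as a subspace, along an ultimately
-- periodic word u s s s … . For that one word the Skolem–Mahler–Lech theorem applies, in the following form:
-- on the stable range of the map A of s, some multiple of a power A^R is congruent to 1 modulo a square p²,
-- so that k ↦ ℓ (A^(R k) z) is a Newton series with rapidly divisible coefficients, and m zeros force p^m to
-- divide ℓ z (Hansel's argument). Hence a valid vector of W lies in one of finitely many proper subspaces, read
-- off from one period. Cutting terminates by the multiset order; when nothing can be cut, every word from a
-- member meets φ within the bound and stays in the list, so that all members consist of valid vectors.

open import Defs
open import Data.Nat using (ℕ; zero; suc; _!)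
import Data.Nat as ℕ
import Data.Nat.Properties as ℕₚ
import Data.Nat.Divisibility as ℕ∣
import Data.Nat.DivMod as ℕ%
import Data.Nat.Coprimality as Coprimality
open import Data.Nat.Induction using (<-rec)
open import Data.Nat.ListAction using (product)
open import Data.Nat.Primality using (Prime; euclidsLemma; prime⇒nonZero; prime⇒nonTrivial)
open import Data.Nat.Primality.Factorisation using (factorise; module PrimeFactorisation)
open import Data.Nat.Tactic.RingSolver using () renaming (solve-∀ to solveℕ-∀)
open import Data.Integer using (ℤ; +_; -[1+_]; 0ℤ; 1ℤ; -1ℤ; _+_; _*_; _-_; -_; ∣_∣; _%ℕ_; _/ℕ_)
import Data.Integer as ℤ
import Data.Integer.Properties as ℤₚ
open import Data.Integer.DivMod using (n%ℕd<d; a≡a%ℕn+[a/ℕn]*n)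
open import Data.Integer.Divisibility.Signed using (_∣_; divides)
import Data.Integer.Divisibility.Signed as ℤ∣
open import Data.Integer.Tactic.RingSolver using (solve-∀)
open import Data.Rational using (ℚ; mkℚ; 0ℚ; 1ℚ; ↥_; ↧_)
import Data.Rational as Q
import Data.Rational.Properties as Qₚ
open import Data.Rational.Unnormalised using (*≡*)
import Data.Rational.Unnormalised.Properties as Qᵘₚ
open import Data.Rational.Solver using (module +-*-Solver)
open import Data.Fin using (Fin; zero; suc; toℕ; fromℕ<; combine; remQuot)
import Data.Fin as Fin
import Data.Fin.Properties as Finₚ
open import Data.Vec using (Vec; []; _∷_; lookup; tabulate)
import Data.Vec as Vec
import Data.Vec.Properties as Vecₚ
open import Data.List using (List; []; _∷_; _++_; length)
import Data.List as List
import Data.List.Properties as Listₚ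
open import Data.List.Membership.Propositional using (_∈_; find)
open import Data.List.Membership.Propositional.Properties using (∈-∃++)
open import Data.List.Relation.Unary.All using (All; []; _∷_)
import Data.List.Relation.Unary.All as All
import Data.List.Relation.Unary.All.Properties as Allₚ
open import Data.List.Relation.Unary.Any using (Any; here; there)
import Data.List.Relation.Unary.Any as Any
import Data.List.Relation.Unary.Any.Properties as Anyₚ
open import Data.Product using (∃; ∃₂; _×_; _,_; proj₁; proj₂)
open import Data.Sum using (_⊎_; inj₁; inj₂; map₁; map₂)
import Data.Sum as Sum
open import Data.Unit using (⊤; tt)
open import Function using (_∘_)
open import Induction.WellFounded using (Acc; acc)
open import Relation.Nullary using (¬_; Dec; yes; no; contradiction; ¬?)
import Relation.Nullary.Decidable as Dec
open import Relation.Binary.PropositionalEquality using (_≡_; _≢_; refl; sym; trans; cong; cong₂; subst; subst₂; module ≡-Reasoning)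

-- Zeros of Newton series

-- Infinitude is replaced by counting because counts obey a constructive pigeonhole principle: which
-- part of a finite union is infinite cannot be decided, but `a + b` positions split as in
-- `atLeast-⊎`.
AtLeast : ℕ → ℕ → (ℕ → Set) → Set
AtLeast zero    N P = ⊤
AtLeast (suc m) N P = ∃ λ i → N ℕ.≤ i × P i × AtLeast m (suc i) P

infinite⇒atLeast : ∀ {P : ℕ → Set} → (∀ N → ∃ λ i → N ℕ.≤ i × P i) → ∀ m N → AtLeast m N P
infinite⇒atLeast inf zero    N = tt
infinite⇒atLeast inf (suc m) N with i , N≤i , Pi ← inf N = i , N≤i , Pi , infinite⇒atLeast inf m (suc i)

atLeast-weaken : ∀ {P m M N} → M ℕ.≤ N → AtLeast m N P → AtLeast m M P
atLeast-weaken {m = zero}  M≤N _ = tt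
atLeast-weaken {m = suc m} M≤N (i , N≤i , Pi , al) = i , ℕₚ.≤-trans M≤N N≤i , Pi , al

-- The new position may depend on the proof of `P i`; this is how a visit is later sent to the
-- number of steps stored in it.
atLeast-map : ∀ {P Q : ℕ → Set} (f : ∀ i → P i → ℕ) →
              (∀ i j p q → i ℕ.< j → f i p ℕ.< f j q) → (∀ i p → Q (f i p)) →
              ∀ m {M N} → (∀ i p → M ℕ.≤ i → N ℕ.≤ f i p) → AtLeast m M P → AtLeast m N Q
atLeast-map f mono pq zero    lb _ = tt
atLeast-map f mono pq (suc m) lb (i , M≤i , Pi , al) =
  f i Pi , lb i Pi M≤i , pq i Pi , atLeast-map f mono pq m (λ j Pj i<j → mono i j Pi Pj i<j) al

atLeast-⊎ : ∀ {P Q : ℕ → Set} a b {N} → AtLeast (a ℕ.+ b) N (λ i → P i ⊎ Q i) → AtLeast a N P ⊎ AtLeast b N Q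
atLeast-⊎ zero    b       al = inj₁ tt
atLeast-⊎ (suc a) zero    al = inj₂ tt
atLeast-⊎ (suc a) (suc b) (i , N≤i , inj₁ Pi , al) with atLeast-⊎ a (suc b) al
... | inj₁ l = inj₁ (i , N≤i , Pi , l)
... | inj₂ r = inj₂ (atLeast-weaken {m = suc b} (ℕₚ.m≤n⇒m≤1+n N≤i) r)
atLeast-⊎ {P} {Q} (suc a) (suc b) (i , N≤i , inj₂ Qi , al)
  with atLeast-⊎ (suc a) b (subst (λ k → AtLeast k (suc i) (λ i → P i ⊎ Q i)) (ℕₚ.+-suc a b) al)
... | inj₁ l = inj₁ (atLeast-weaken {m = suc a} (ℕₚ.m≤n⇒m≤1+n N≤i) l)
... | inj₂ r = inj₂ (i , N≤i , Qi , r)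

-- Finitely many zeros lie below a common bound, so a Newton polynomial of finite degree sees all of
-- them.
atLeast-bounded : ∀ {P : ℕ → Set} m {N} → AtLeast m N P → ∃ λ n → AtLeast m N (λ i → P i × i ℕ.< n)
atLeast-bounded {P} m {N} al = bound m al , go m al ℕₚ.≤-refl
  where
  bound : ∀ m {N} → AtLeast m N P → ℕ
  bound zero    _                = 0
  bound (suc m) (i , _ , _ , al) = suc i ℕ.⊔ bound m al
  go : ∀ m {N n} (al : AtLeast m N P) → bound m al ℕ.≤ n → AtLeast m N (λ i → P i × i ℕ.< n)
  go zero    _                    _ = tt
  go (suc m) (i , N≤i , Pi , al) le =
    i , N≤i , (Pi , ℕₚ.≤-trans (ℕₚ.m≤m⊔n (suc i) (bound m al)) le) , go m al (ℕₚ.≤-trans (ℕₚ.m≤n⊔m (suc i) (bound m al)) le)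

-- Integer polynomials up to extensional equality. The centre a of each Horner step is arbitrary, so that
-- both the Newton form below and the quotient by y - r are of this shape without any expansion.
data IsPoly : (ℤ → ℤ) → Set where
  poly-zero : ∀ {f} → (∀ y → f y ≡ 0ℤ) → IsPoly f
  poly-step : ∀ {f g} a d → IsPoly g → (∀ y → f y ≡ d + (y - a) * g y) → IsPoly f

-- Divide the inner `g` first, and in front of `g r` split `y - a` into `(r - a) + (y - r)`; the
-- quotient is again a Horner step with centre `a`.
poly-divide : ∀ {f} → IsPoly f → ∀ r → ∃ λ g → IsPoly g × (∀ y → f y ≡ f r + (y - r) * g y)
poly-divide (poly-zero f≡0) r = (λ _ → 0ℤ) , poly-zero (λ _ → refl) , λ y →
  trans (f≡0 y) (trans (lemma y r) (cong (_+ (y - r) * 0ℤ) (sym (f≡0 r))))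
  where
  lemma : ∀ y r → 0ℤ ≡ 0ℤ + (y - r) * 0ℤ
  lemma = solve-∀
poly-divide {f} (poly-step {g = g} a d pg f≡) r with g′ , pg′ , g≡ ← poly-divide pg r =
  (λ y → g r + (y - a) * g′ y) , poly-step a (g r) pg′ (λ _ → refl) , λ y → begin
    f y                                                    ≡⟨ f≡ y ⟩
    d + (y - a) * g y                                      ≡⟨ cong (λ h → d + (y - a) * h) (g≡ y) ⟩
    d + (y - a) * (g r + (y - r) * g′ y)                   ≡⟨ lemma d y a r (g r) (g′ y) ⟩
    (d + (r - a) * g r) + (y - r) * (g r + (y - a) * g′ y) ≡⟨ cong (_+ _) (sym (f≡ r)) ⟩
    f r + (y - r) * (g r + (y - a) * g′ y)                 ∎
  where
  open ≡-Reasoning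
  lemma : ∀ d y a r s t → d + (y - a) * (s + (y - r) * t) ≡ (d + (r - a) * s) + (y - r) * (s + (y - a) * t)
  lemma = solve-∀

≢0-* : ∀ {a b} → a ≢ 0ℤ → b ≢ 0ℤ → a * b ≢ 0ℤ
≢0-* {a} {b} a≢0 b≢0 ab≡0 with ℤₚ.i*j≡0⇒i≡0∨j≡0 a ab≡0
... | inj₁ a≡0 = a≢0 a≡0
... | inj₂ b≡0 = b≢0 b≡0

cancel-≢0 : ∀ {a b} → a ≢ 0ℤ → a * b ≡ 0ℤ → b ≡ 0ℤ
cancel-≢0 {a} a≢0 ab≡0 with ℤₚ.i*j≡0⇒i≡0∨j≡0 a ab≡0
... | inj₁ a≡0 = contradiction a≡0 a≢0
... | inj₂ b≡0 = b≡0

-- Each root p * k splits off the factor y - p * k, which contributes a factor p at y = 0.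
roots⇒divides : ∀ p → .{{ℕ.NonZero p}} → ∀ {f} → IsPoly f → ∀ m {N} →
                AtLeast m N (λ k → f (+ p * + k) ≡ 0ℤ) → (+ (p ℕ.^ m)) ∣ f 0ℤ
roots⇒divides p {f} pf zero    _ = divides (f 0ℤ) (sym (ℤₚ.*-identityʳ (f 0ℤ)))
roots⇒divides p {f} pf (suc m) (k , _ , fk≡0 , al) with g , pg , f≡ ← poly-divide pf (+ p * + k)
  = lemma (roots⇒divides p pg m (roots m ℕₚ.≤-refl al))
  where
  step : ∀ y → f y ≡ (y - + p * + k) * g y
  step y = trans (f≡ y) (trans (cong (_+ _) fk≡0) (ℤₚ.+-identityˡ _))
  -- The remaining zeros lie strictly beyond `k`, so the factor `p * j - p * k` is nonzero there and
  -- can be cancelled.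
  roots : ∀ m {N} → k ℕ.< N → AtLeast m N (λ k → f (+ p * + k) ≡ 0ℤ) → AtLeast m N (λ k → g (+ p * + k) ≡ 0ℤ)
  roots zero    _   _                     = tt
  roots (suc m) k<N (j , N≤j , fj≡0 , al) =
    j , N≤j , cancel-≢0 ne (trans (sym (step _)) fj≡0) , roots m (ℕₚ.m<n⇒m<1+n (ℕₚ.<-≤-trans k<N N≤j)) al
    where
    ne : + p * + j - + p * + k ≢ 0ℤ
    ne eq = ℕₚ.<⇒≢ (ℕₚ.<-≤-trans k<N N≤j)
      (sym (ℤₚ.+-injective (ℤₚ.*-cancelˡ-≡ (+ p) (+ j) (+ k) (ℤₚ.i-j≡0⇒i≡j _ _ eq))))
  lemma : (+ (p ℕ.^ m)) ∣ g 0ℤ → (+ (p ℕ.^ suc m)) ∣ f 0ℤ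
  lemma (divides q g0≡) = divides (- (+ k * q)) (begin
    f 0ℤ                               ≡⟨ step 0ℤ ⟩
    (0ℤ - + p * + k) * g 0ℤ            ≡⟨ cong ((0ℤ - + p * + k) *_) g0≡ ⟩
    (0ℤ - + p * + k) * (q * + (p ℕ.^ m)) ≡⟨ alg (+ p) (+ k) q _ ⟩
    - (+ k * q) * (+ p * + (p ℕ.^ m))  ≡⟨ cong (- (+ k * q) *_) (sym (ℤₚ.pos-* p (p ℕ.^ m))) ⟩
    - (+ k * q) * + (p ℕ.^ suc m)      ∎)
    where
    open ≡-Reasoning
    alg : ∀ p k q r → (0ℤ - p * k) * (q * r) ≡ - (k * q) * (p * r)
    alg = solve-∀

-- Prime powers against factorials

module _ {p} (pr : Prime p) where

  private instance
    p≢0 : ℕ.NonZero p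
    p≢0 = prime⇒nonZero pr

  1<p : 1 ℕ.< p
  1<p = ℕ.nonTrivial⇒n>1 p {{prime⇒nonTrivial pr}}

  ∤-* : ∀ {a b} → ¬ p ℕ∣.∣ a → ¬ p ℕ∣.∣ b → ¬ p ℕ∣.∣ a ℕ.* b
  ∤-* {a} {b} ¬a ¬b p∣ab with euclidsLemma a b pr p∣ab
  ... | inj₁ d = ¬a d
  ... | inj₂ d = ¬b d

  ∤-1 : ¬ p ℕ∣.∣ 1
  ∤-1 d = ℕₚ.<⇒≢ 1<p (sym (ℕ∣.∣1⇒≡1 d))

  -- Divisibility after localising at `p`: a comparison of `p`-adic valuations that avoids a
  -- valuation function.
  _∣ₚ_ : ℕ → ℕ → Set
  n ∣ₚ x = ∃ λ E → ¬ (p ℕ∣.∣ E) × n ℕ∣.∣ (E ℕ.* x)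

  ∤-residue : ∀ q r → suc r ℕ.< p → ¬ p ℕ∣.∣ (suc r ℕ.+ p ℕ.* q)
  ∤-residue q r r<p d = ℕₚ.<⇒≱ r<p (ℕ∣.∣⇒≤ (ℕ∣.∣m+n∣m⇒∣n
    (subst (p ℕ∣.∣_) (ℕₚ.+-comm (suc r) (p ℕ.* q)) d) (ℕ∣.m∣m*n q)))

  -- Between consecutive multiples of `p` every new factor of the factorial is prime to `p` and is
  -- absorbed into `E`.
  !-block : ∀ q x → ((p ℕ.* q) !) ∣ₚ x → ∀ r → r ℕ.< p → ((r ℕ.+ p ℕ.* q) !) ∣ₚ x
  !-block q x sp zero    _   = sp
  !-block q x sp (suc r) r<p with E , ¬E , d ← !-block q x sp r (ℕₚ.<-trans (ℕₚ.n<1+n r) r<p) =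
    s ℕ.* E , ∤-* (∤-residue q r r<p) ¬E ,
    subst ((s ℕ.* (r ℕ.+ p ℕ.* q) !) ℕ∣.∣_) (sym (ℕₚ.*-assoc s E x)) (ℕ∣.*-monoʳ-∣ s d)
    where
    s : ℕ
    s = suc (r ℕ.+ p ℕ.* q)

  -- Legendre's recursion: up to factors prime to `p`, only the multiples of `p` count in
  -- `(p * q) !`, and their product is `p ^ q * q !`.
  !-multiple : ∀ q → ((p ℕ.* q) !) ∣ₚ (p ℕ.^ q ℕ.* q !)
  !-multiple zero rewrite ℕₚ.*-zeroʳ p = 1 , ∤-1 , ℕ∣.∣-refl
  !-multiple (suc q) with E , ¬E , d ← !-block q _ (!-multiple q) (ℕ.pred p) (ℕₚ.≤-reflexive (ℕₚ.suc-pred p)) =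
    E , ¬E , subst₂ ℕ∣._∣_ (sym (trans (cong _! eq) (cong (ℕ._* (ℕ.pred p ℕ.+ p ℕ.* q) !) (sym eq))))
               (alg p (suc q) E (p ℕ.^ q) (q !)) (ℕ∣.*-monoʳ-∣ (p ℕ.* suc q) d)
    where
    eq : p ℕ.* suc q ≡ suc (ℕ.pred p ℕ.+ p ℕ.* q)
    eq = trans (ℕₚ.*-suc p q) (cong (ℕ._+ p ℕ.* q) (sym (ℕₚ.suc-pred p)))
    alg : ∀ p s E x y → (p ℕ.* s) ℕ.* (E ℕ.* (x ℕ.* y)) ≡ E ℕ.* ((p ℕ.* x) ℕ.* (s ℕ.* y))
    alg = solveℕ-∀

  ^-monoʳ-∣ : ∀ {a b} → a ℕ.≤ b → p ℕ.^ a ℕ∣.∣ p ℕ.^ b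
  ^-monoʳ-∣ {a} {b} a≤b with c , refl ← ℕₚ.m≤n⇒∃[o]m+o≡n a≤b =
    subst (p ℕ.^ a ℕ∣.∣_) (sym (ℕₚ.^-distribˡ-+-* p a c)) (ℕ∣.m∣m*n (p ℕ.^ c))

  !-double : ∀ q → (q !) ∣ₚ (p ℕ.^ q) → ((p ℕ.* q) !) ∣ₚ (p ℕ.^ (q ℕ.+ q))
  !-double q (E₁ , ¬E₁ , d₁) with E₂ , ¬E₂ , d₂ ← !-multiple q =
    E₂ ℕ.* E₁ , ∤-* ¬E₂ ¬E₁ ,
    ℕ∣.∣-trans d₂ (subst ((E₂ ℕ.* (p ℕ.^ q ℕ.* q !)) ℕ∣.∣_) eq (ℕ∣.*-monoʳ-∣ E₂ (ℕ∣.*-monoʳ-∣ (p ℕ.^ q) d₁)))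
    where
    alg : ∀ E₁ E₂ x → E₂ ℕ.* (x ℕ.* (E₁ ℕ.* x)) ≡ E₂ ℕ.* E₁ ℕ.* (x ℕ.* x)
    alg = solveℕ-∀
    eq : E₂ ℕ.* (p ℕ.^ q ℕ.* (E₁ ℕ.* p ℕ.^ q)) ≡ E₂ ℕ.* E₁ ℕ.* p ℕ.^ (q ℕ.+ q)
    eq = trans (alg E₁ E₂ (p ℕ.^ q)) (cong (E₂ ℕ.* E₁ ℕ.*_) (sym (ℕₚ.^-distribˡ-+-* p q q)))

  -- In terms of valuations, v_p(n!) ≤ n. Strong induction passes from `n / p` to `n`: Legendre's
  -- recursion doubles the exponent, and since `p` is at least 2 the doubled quotient is still at
  -- most `n`.
  !-power : ∀ n → (n !) ∣ₚ (p ℕ.^ n)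
  !-power = <-rec _ step
    where
    step : ∀ n → (∀ {m} → m ℕ.< n → (m !) ∣ₚ (p ℕ.^ m)) → (n !) ∣ₚ (p ℕ.^ n)
    step zero      ih = 1 , ∤-1 , ℕ∣.∣-refl
    step n@(suc _) ih
      with E , ¬E , d ← !-block (n ℕ./ p) _ (!-double (n ℕ./ p) (ih (ℕ%.m/n<m n p 1<p))) (n ℕ.% p) (ℕ%.m%n<n n p)
      = E , ¬E , ℕ∣.∣-trans (subst (λ k → k ! ℕ∣.∣ (E ℕ.* p ℕ.^ (q ℕ.+ q))) (sym n≡) d) (ℕ∣.*-monoʳ-∣ E (^-monoʳ-∣ le))
      where
      q : ℕ
      q = n ℕ./ p
      n≡ : n ≡ n ℕ.% p ℕ.+ p ℕ.* q
      n≡ = trans (ℕ%.m≡m%n+[m/n]*n n p) (cong (n ℕ.% p ℕ.+_) (ℕₚ.*-comm q p))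
      le : q ℕ.+ q ℕ.≤ n
      le = ℕₚ.≤-trans (ℕₚ.≤-reflexive (cong (q ℕ.+_) (sym (ℕₚ.+-identityʳ q))))
             (ℕₚ.≤-trans (ℕₚ.*-monoˡ-≤ q 1<p)
               (ℕₚ.≤-trans (ℕₚ.m≤n+m (p ℕ.* q) (n ℕ.% p)) (ℕₚ.≤-reflexive (sym n≡))))

  -- All coefficients of one polynomial are to be cleared by a single multiplier, so the individual
  -- ones are multiplied together.
  !-power-uniform : ∀ N → ∃ λ E → ¬ (p ℕ∣.∣ E) × (∀ j → j ℕ.< N → j ! ℕ∣.∣ (E ℕ.* p ℕ.^ j))
  !-power-uniform zero = 1 , ∤-1 , λ _ ()
  !-power-uniform (suc N) with E , ¬E , d ← !-power-uniform N | E′ , ¬E′ , d′ ← !-power N =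
    E′ ℕ.* E , ∤-* ¬E′ ¬E , div
    where
    div : ∀ j → j ℕ.< suc N → j ! ℕ∣.∣ (E′ ℕ.* E ℕ.* p ℕ.^ j)
    div j j<sN with ℕₚ.m<1+n⇒m<n∨m≡n j<sN
    ... | inj₁ j<N  = subst (j ! ℕ∣.∣_) (sym (ℕₚ.*-assoc E′ E _)) (ℕ∣.∣n⇒∣m*n E′ (d j j<N))
    ... | inj₂ refl = subst (j ! ℕ∣.∣_) (alg E E′ (p ℕ.^ j)) (ℕ∣.∣n⇒∣m*n E d′)
      where
      alg : ∀ a b c → a ℕ.* (b ℕ.* c) ≡ b ℕ.* a ℕ.* c
      alg = solveℕ-∀

  ^-cancel-∤ : ∀ m {E b} → ¬ (p ℕ∣.∣ E) → p ℕ.^ m ℕ∣.∣ (E ℕ.* b) → p ℕ.^ m ℕ∣.∣ b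
  ^-cancel-∤ zero    ¬E d = ℕ∣.1∣ _
  ^-cancel-∤ (suc m) {E} {b} ¬E d with euclidsLemma E b pr (ℕ∣.∣-trans (ℕ∣.m∣m*n (p ℕ.^ m)) d)
  ... | inj₁ p∣E = contradiction p∣E ¬E
  ... | inj₂ (ℕ∣.divides c refl) = subst (p ℕ.^ suc m ℕ∣.∣_) (ℕₚ.*-comm p c) (ℕ∣.*-monoʳ-∣ p
          (^-cancel-∤ m ¬E (ℕ∣.*-cancelˡ-∣ p (subst (p ℕ.^ suc m ℕ∣.∣_) (alg E c p) d))))
    where
    alg : ∀ E c p → E ℕ.* (c ℕ.* p) ≡ p ℕ.* (E ℕ.* c)
    alg = solveℕ-∀

-- Finite sums and binomial coefficients

∑< : ℕ → (ℕ → ℤ) → ℤ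
∑< zero    u = 0ℤ
∑< (suc N) u = u 0 + ∑< N (u ∘ suc)

∑<-cong : ∀ N {u v : ℕ → ℤ} → (∀ j → j ℕ.< N → u j ≡ v j) → ∑< N u ≡ ∑< N v
∑<-cong zero    eq = refl
∑<-cong (suc N) eq = cong₂ _+_ (eq 0 (ℕ.s≤s ℕ.z≤n)) (∑<-cong N (λ j j<N → eq (suc j) (ℕ.s≤s j<N)))

∑<-+ : ∀ N u v → ∑< N (λ j → u j + v j) ≡ ∑< N u + ∑< N v
∑<-+ zero    u v = refl
∑<-+ (suc N) u v = trans (cong (_+_ (u 0 + v 0)) (∑<-+ N (u ∘ suc) (v ∘ suc))) (alg (u 0) (v 0) _ _)
  where
  alg : ∀ a b c d → a + b + (c + d) ≡ a + c + (b + d)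
  alg = solve-∀

∑<-* : ∀ N c u → c * ∑< N u ≡ ∑< N (λ j → c * u j)
∑<-* zero    c u = ℤₚ.*-zeroʳ c
∑<-* (suc N) c u = trans (ℤₚ.*-distribˡ-+ c (u 0) _) (cong (_+_ (c * u 0)) (∑<-* N c (u ∘ suc)))

∑<-zero : ∀ N {u : ℕ → ℤ} → (∀ j → u j ≡ 0ℤ) → ∑< N u ≡ 0ℤ
∑<-zero zero    u≡0 = refl
∑<-zero (suc N) u≡0 = cong₂ _+_ (u≡0 0) (∑<-zero N (u≡0 ∘ suc))

binomial : ℕ → ℕ → ℤ
binomial k       zero    = 1ℤ
binomial zero    (suc j) = 0ℤ
binomial (suc k) (suc j) = binomial k j + binomial k (suc j)

-- Pascal's rule reduces this to the same identity for `k` at `j` and at its predecessor.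
-- Subtraction in ℤ covers `j ≥ k` as well, where both sides vanish.
binomial-step : ∀ k j → + suc j * binomial k (suc j) ≡ (+ k - + j) * binomial k j
binomial-step zero    zero    = refl
binomial-step zero    (suc j) = trans (ℤₚ.*-zeroʳ (+ suc (suc j))) (sym (ℤₚ.*-zeroʳ (0ℤ - + suc j)))
binomial-step (suc k) zero    = trans (cong (1ℤ *_) (cong (_+_ 1ℤ) (trans (sym (ℤₚ.*-identityˡ _)) (binomial-step k zero)))) (alg (+ k))
  where
  alg : ∀ k → 1ℤ * (1ℤ + (k - 0ℤ) * 1ℤ) ≡ (1ℤ + k - 0ℤ) * 1ℤ
  alg = solve-∀
binomial-step (suc k) (suc j) = begin
  (1ℤ + (1ℤ + J)) * (b₁ + b₂)                    ≡⟨ alg₁ J b₁ b₂ ⟩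
  (1ℤ + J) * b₁ + b₁ + (1ℤ + (1ℤ + J)) * b₂      ≡⟨ cong (_+_ ((1ℤ + J) * b₁ + b₁)) (binomial-step k (suc j)) ⟩
  (1ℤ + J) * b₁ + b₁ + (K - (1ℤ + J)) * b₁       ≡⟨ cong (λ z → z + b₁ + (K - (1ℤ + J)) * b₁) (binomial-step k j) ⟩
  (K - J) * b₀ + b₁ + (K - (1ℤ + J)) * b₁        ≡⟨ alg₂ J K b₀ b₁ ⟩
  (1ℤ + K - (1ℤ + J)) * (b₀ + b₁)                ∎
  where
  open ≡-Reasoning
  J = + j
  K = + k
  b₀ = binomial k j
  b₁ = binomial k (suc j)
  b₂ = binomial k (suc (suc j))
  alg₁ : ∀ J b₁ b₂ → (1ℤ + (1ℤ + J)) * (b₁ + b₂) ≡ (1ℤ + J) * b₁ + b₁ + (1ℤ + (1ℤ + J)) * b₂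
  alg₁ = solve-∀
  alg₂ : ∀ J K b₀ b₁ → (K - J) * b₀ + b₁ + (K - (1ℤ + J)) * b₁ ≡ (1ℤ + K - (1ℤ + J)) * (b₀ + b₁)
  alg₂ = solve-∀

-- Newton interpolation with divisible differences

module _ {p} (pr : Prime p) (P′ : ℤ) (c : ℕ → ℕ → ℤ)
         (c-step : ∀ k i → c (suc k) i ≡ c k i + + p * + p * P′ * c k (suc i)) where

  private
    instance
      p≢0 : ℕ.NonZero p
      p≢0 = prime⇒nonZero pr
    P : ℤ
    P = + p * + p * P′

  -- By `c-step` the forward difference in `k` of a column is `P` times the next column, so
  -- `P ^ j * c 0 (j + i)` is a `j`-th difference at 0 and this is Newton's forward formula. Every
  -- `N` beyond `k` is allowed, so that one length serves a whole range of points.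
  newton-expansion : ∀ k N i → k ℕ.< N → c k i ≡ ∑< N (λ j → binomial k j * (P ℤ.^ j * c 0 (j ℕ.+ i)))
  newton-expansion zero    (suc N) i _ = sym (trans (cong₂ _+_
      (trans (ℤₚ.*-identityˡ (1ℤ * c 0 i)) (ℤₚ.*-identityˡ (c 0 i))) (∑<-zero N (λ j → refl))) (ℤₚ.+-identityʳ (c 0 i)))
  newton-expansion (suc k) (suc N) i (ℕ.s≤s k<N) = begin
    c (suc k) i                 ≡⟨ c-step k i ⟩
    c k i + P * c k (suc i)     ≡⟨ cong₂ (λ x y → x + P * y) (newton-expansion k (suc N) i (ℕₚ.m<n⇒m<1+n k<N))
                                     (newton-expansion k N (suc i) k<N) ⟩
    (u 0 + ∑< N (u ∘ suc)) + P * ∑< N v     ≡⟨ cong (_+_ (u 0 + ∑< N (u ∘ suc))) (∑<-* N P v) ⟩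
    (u 0 + ∑< N (u ∘ suc)) + ∑< N (λ j → P * v j) ≡⟨ alg₁ (u 0) _ _ ⟩
    u 0 + (∑< N (λ j → P * v j) + ∑< N (u ∘ suc)) ≡⟨ cong (_+_ (u 0)) (sym (∑<-+ N _ (u ∘ suc))) ⟩
    u 0 + ∑< N (λ j → P * v j + u (suc j))  ≡⟨ cong (_+_ (u 0)) (∑<-cong N (λ j _ → term j)) ⟩
    ∑< (suc N) (λ j → binomial (suc k) j * (P ℤ.^ j * c 0 (j ℕ.+ i))) ∎
    where
    open ≡-Reasoning
    u v : ℕ → ℤ
    u j = binomial k j * (P ℤ.^ j * c 0 (j ℕ.+ i))
    v j = binomial k j * (P ℤ.^ j * c 0 (j ℕ.+ suc i))
    alg₁ : ∀ a b c → a + b + c ≡ a + (c + b)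
    alg₁ = solve-∀
    alg₂ : ∀ P b q x b′ → P * (b * (q * x)) + b′ * (P * q * x) ≡ (b + b′) * (P * q * x)
    alg₂ = solve-∀
    term : ∀ j → P * v j + u (suc j) ≡ binomial (suc k) (suc j) * (P ℤ.^ suc j * c 0 (suc j ℕ.+ i))
    term j = trans (cong (λ h → P * (binomial k j * (P ℤ.^ j * c 0 h)) + u (suc j)) (ℕₚ.+-suc j i))
                   (alg₂ P (binomial k j) (P ℤ.^ j) (c 0 (suc j ℕ.+ i)) (binomial k (suc j)))

  -- The Newton polynomial in nested form with nodes `p * j`, `p * suc j`, and so on. Its variable
  -- stands for `p * k`, not for `k`.
  newton : (ℕ → ℤ) → ℕ → ℕ → ℤ → ℤ
  newton d zero    j y = 0ℤ
  newton d (suc N) j y = d j + (y - + p * + j) * newton d N (suc j) y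

  newton-isPoly : ∀ d N j → IsPoly (newton d N j)
  newton-isPoly d zero    j = poly-zero (λ _ → refl)
  newton-isPoly d (suc N) j = poly-step (+ p * + j) (d j) (newton-isPoly d N (suc j)) (λ _ → refl)

  -- This is `p ^ j` times the falling factorial k (k - 1) ... (k - j + 1).
  falling : ℕ → ℕ → ℤ
  falling k zero    = 1ℤ
  falling k (suc j) = falling k j * (+ p * + k - + p * + j)

  -- The prefactor carries the linear factors of the levels already passed, which lets the recursion
  -- run over the inner levels.
  newton-sum : ∀ d N k j → falling k j * newton d N j (+ p * + k) ≡ ∑< N (λ i → falling k (i ℕ.+ j) * d (i ℕ.+ j))
  newton-sum d zero    k j = ℤₚ.*-zeroʳ (falling k j)
  newton-sum d (suc N) k j = begin
    falling k j * (d j + x * newton d N (suc j) (+ p * + k))                ≡⟨ alg (falling k j) (d j) x _ ⟩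
    falling k j * d j + falling k (suc j) * newton d N (suc j) (+ p * + k)  ≡⟨ cong (_+_ (falling k j * d j)) (newton-sum d N k (suc j)) ⟩
    falling k j * d j + ∑< N (λ i → falling k (i ℕ.+ suc j) * d (i ℕ.+ suc j))
      ≡⟨ cong (_+_ (falling k j * d j)) (∑<-cong N (λ i _ → cong (λ h → falling k h * d h) (ℕₚ.+-suc i j))) ⟩
    falling k j * d j + ∑< N (λ i → falling k (suc i ℕ.+ j) * d (suc i ℕ.+ j)) ∎
    where
    open ≡-Reasoning
    x : ℤ
    x = + p * + k - + p * + j
    alg : ∀ f d x n → f * (d + x * n) ≡ f * d + (f * x) * n
    alg = solve-∀

  binomial-falling : ∀ k j → + (j !) * binomial k j * (+ p) ℤ.^ j ≡ falling k j
  binomial-falling k zero    = refl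
  binomial-falling k (suc j) = begin
    + (suc j !) * binomial k (suc j) * (+ p * (+ p) ℤ.^ j)
      ≡⟨ cong (λ h → h * binomial k (suc j) * (+ p * (+ p) ℤ.^ j)) (ℤₚ.pos-* (suc j) (j !)) ⟩
    + suc j * + (j !) * binomial k (suc j) * (+ p * (+ p) ℤ.^ j)
      ≡⟨ alg₁ (+ suc j) (+ (j !)) (binomial k (suc j)) (+ p) _ ⟩
    + (j !) * (+ suc j * binomial k (suc j)) * (+ p * (+ p) ℤ.^ j)
      ≡⟨ cong (λ h → + (j !) * h * (+ p * (+ p) ℤ.^ j)) (binomial-step k j) ⟩
    + (j !) * ((+ k - + j) * binomial k j) * (+ p * (+ p) ℤ.^ j)
      ≡⟨ alg₂ (+ (j !)) (+ k) (+ j) (binomial k j) (+ p) _ ⟩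
    + (j !) * binomial k j * (+ p) ℤ.^ j * (+ p * + k - + p * + j)
      ≡⟨ cong (_* (+ p * + k - + p * + j)) (binomial-falling k j) ⟩
    falling k (suc j) ∎
    where
    open ≡-Reasoning
    alg₁ : ∀ s f b p q → s * f * b * (p * q) ≡ f * (s * b) * (p * q)
    alg₁ = solve-∀
    alg₂ : ∀ f k j b p q → f * ((k - j) * b) * (p * q) ≡ f * b * q * (p * k - p * j)
    alg₂ = solve-∀

  pos-^ : ∀ j → + (p ℕ.^ j) ≡ (+ p) ℤ.^ j
  pos-^ zero    = refl
  pos-^ (suc j) = trans (ℤₚ.pos-* p (p ℕ.^ j)) (cong (+ p *_) (pos-^ j))

  P^-split : ∀ j → P ℤ.^ j ≡ (+ p) ℤ.^ j * (+ p) ℤ.^ j * P′ ℤ.^ j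
  P^-split zero    = refl
  P^-split (suc j) = trans (cong (P *_) (P^-split j)) (alg (+ p) P′ _ _)
    where
    alg : ∀ p P q r → p * p * P * (q * q * r) ≡ p * q * (p * q) * (P * r)
    alg = solve-∀

  module _ (N E : ℕ) (!-div : ∀ j → j ℕ.< N → j ! ℕ∣.∣ (E ℕ.* p ℕ.^ j)) where

    -- The integer E p^j / j! for `j < N`, extended by zero because `newton` takes coefficients on
    -- all of ℕ.
    quot : ℕ → ℤ
    quot j with j ℕ.<? N
    ... | yes j<N = + ℕ∣.quotient (!-div j j<N)
    ... | no  _   = 0ℤ

    quot-≡ : ∀ j → j ℕ.< N → + E * (+ p) ℤ.^ j ≡ quot j * + (j !)
    quot-≡ j j<N with j ℕ.<? N
    ... | no j≮N = contradiction j<N j≮N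
    ... | yes lt = begin
      + E * (+ p) ℤ.^ j                        ≡⟨ cong (+ E *_) (sym (pos-^ j)) ⟩
      + E * + (p ℕ.^ j)                        ≡⟨ sym (ℤₚ.pos-* E (p ℕ.^ j)) ⟩
      + (E ℕ.* p ℕ.^ j)                        ≡⟨ cong +_ (ℕ∣._∣_.equality (!-div j lt)) ⟩
      + (ℕ∣.quotient (!-div j lt) ℕ.* j !)     ≡⟨ ℤₚ.pos-* (ℕ∣.quotient (!-div j lt)) (j !) ⟩
      + ℕ∣.quotient (!-div j lt) * + (j !)     ∎
      where open ≡-Reasoning

    coeff : ℕ → ℤ
    coeff j = quot j * (P′ ℤ.^ j * c 0 j)

    interpolate : ∀ k → k ℕ.< N → newton coeff N 0 (+ p * + k) ≡ + E * c k 0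
    interpolate k k<N = begin
      newton coeff N 0 (+ p * + k)                               ≡⟨ sym (ℤₚ.*-identityˡ _) ⟩
      1ℤ * newton coeff N 0 (+ p * + k)                          ≡⟨ newton-sum coeff N k 0 ⟩
      ∑< N (λ j → falling k (j ℕ.+ 0) * coeff (j ℕ.+ 0))         ≡⟨ ∑<-cong N term ⟩
      ∑< N (λ j → + E * (binomial k j * (P ℤ.^ j * c 0 (j ℕ.+ 0)))) ≡⟨ sym (∑<-* N (+ E) _) ⟩
      + E * ∑< N (λ j → binomial k j * (P ℤ.^ j * c 0 (j ℕ.+ 0)))   ≡⟨ cong (+ E *_) (sym (newton-expansion k N 0 k<N)) ⟩
      + E * c k 0                                                ∎
      where
      open ≡-Reasoning
      alg₁ : ∀ f b x q r y → f * b * x * (q * (r * y)) ≡ (q * f) * (b * (x * (r * y)))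
      alg₁ = solve-∀
      alg₂ : ∀ e x b r y → (e * x) * (b * (x * (r * y))) ≡ e * (b * (x * x * r * y))
      alg₂ = solve-∀
      term : ∀ j → j ℕ.< N → falling k (j ℕ.+ 0) * coeff (j ℕ.+ 0) ≡ + E * (binomial k j * (P ℤ.^ j * c 0 (j ℕ.+ 0)))
      term j j<N rewrite ℕₚ.+-identityʳ j = begin
        falling k j * coeff j
          ≡⟨ cong (_* coeff j) (sym (binomial-falling k j)) ⟩
        + (j !) * binomial k j * (+ p) ℤ.^ j * (quot j * (P′ ℤ.^ j * c 0 j))
          ≡⟨ alg₁ (+ (j !)) (binomial k j) ((+ p) ℤ.^ j) (quot j) (P′ ℤ.^ j) (c 0 j) ⟩
        (quot j * + (j !)) * (binomial k j * ((+ p) ℤ.^ j * (P′ ℤ.^ j * c 0 j)))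
          ≡⟨ cong (_* _) (sym (quot-≡ j j<N)) ⟩
        (+ E * (+ p) ℤ.^ j) * (binomial k j * ((+ p) ℤ.^ j * (P′ ℤ.^ j * c 0 j)))
          ≡⟨ alg₂ (+ E) ((+ p) ℤ.^ j) (binomial k j) (P′ ℤ.^ j) (c 0 j) ⟩
        + E * (binomial k j * ((+ p) ℤ.^ j * (+ p) ℤ.^ j * P′ ℤ.^ j * c 0 j))
          ≡⟨ cong (λ h → + E * (binomial k j * (h * c 0 j))) (sym (P^-split j)) ⟩
        + E * (binomial k j * (P ℤ.^ j * c 0 j)) ∎

  -- Multiplying by E turns the Newton series of c into an integer polynomial in p * k: one factor p of
  -- P = p * p * P′ pays for the denominators j !, the other one scales the variable.
  zeros⇒divides : ∀ m {M} → AtLeast m M (λ k → c k 0 ≡ 0ℤ) → p ℕ.^ m ℕ∣.∣ ∣ c 0 0 ∣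
  zeros⇒divides m al with N , al′ ← atLeast-bounded m al
    -- Length `suc N` includes the point `k = 0`, where the divisibility is read off, even if `N` is
    -- zero.
    with E , ¬E , !-div ← !-power-uniform pr (suc N) =
      ^-cancel-∤ pr m ¬E (subst (p ℕ.^ m ℕ∣.∣_) eq (ℤ∣.∣⇒∣ᵤ
        (roots⇒divides p (newton-isPoly (coeff (suc N) E !-div) (suc N) 0) m
          (atLeast-map (λ k _ → k) (λ _ _ _ _ k<l → k<l) root m (λ _ _ le → le) al′))))
    where
    root : ∀ k → c k 0 ≡ 0ℤ × k ℕ.< N → newton (coeff (suc N) E !-div) (suc N) 0 (+ p * + k) ≡ 0ℤ
    root k (ck≡0 , k<N) = trans (interpolate (suc N) E !-div k (ℕₚ.m<n⇒m<1+n k<N))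
                                (trans (cong (+ E *_) ck≡0) (ℤₚ.*-zeroʳ (+ E)))
    eq : ∣ newton (coeff (suc N) E !-div) (suc N) 0 0ℤ ∣ ≡ E ℕ.* ∣ c 0 0 ∣
    eq = trans (cong ∣_∣ (trans (cong (newton (coeff (suc N) E !-div) (suc N) 0) (sym (ℤₚ.*-zeroʳ (+ p))))
                                (interpolate (suc N) E !-div 0 (ℕ.s≤s ℕ.z≤n))))
               (ℤₚ.abs-* (+ E) (c 0 0))

  -- Take the absolute value m of `c 0 0` itself as the number of zeros: p^m exceeds m, so it cannot
  -- divide a nonzero integer of absolute value m.
  zeros-bounded : c 0 0 ≢ 0ℤ → ¬ AtLeast ∣ c 0 0 ∣ 0 (λ k → c k 0 ≡ 0ℤ)
  zeros-bounded c≢0 al = ℕₚ.<⇒≱ (n<p^n ∣ c 0 0 ∣)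
    (ℕ∣.∣⇒≤ {{ℕ.≢-nonZero (λ eq → c≢0 (ℤₚ.∣i∣≡0⇒i≡0 eq))}} (zeros⇒divides ∣ c 0 0 ∣ al))
    where
    n<p^n : ∀ n → n ℕ.< p ℕ.^ n
    n<p^n zero    = ℕ.s≤s ℕ.z≤n
    n<p^n (suc n) = ℕₚ.≤-trans (ℕₚ.+-mono-≤ (ℕ.s≤s (ℕ.z≤n {n})) (n<p^n n))
      (ℕₚ.≤-trans (ℕₚ.+-monoˡ-≤ (p ℕ.^ n) (n<p^n n))
        (ℕₚ.≤-trans (ℕₚ.≤-reflexive (cong (p ℕ.^ n ℕ.+_) (sym (ℕₚ.+-identityʳ (p ℕ.^ n)))))
          (ℕₚ.*-monoˡ-≤ (p ℕ.^ n) (1<p pr))))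

-- Linear algebra over ℤ

private variable
  d D E F : ℕ

infixl 6 _⊞_
infixr 7 _⊡_

_⊞_ : Vec ℤ D → Vec ℤ D → Vec ℤ D
_⊞_ = Vec.zipWith _+_

_⊡_ : ℤ → Vec ℤ D → Vec ℤ D
c ⊡ x = Vec.map (c *_) x

0⃗ : Vec ℤ D
0⃗ = Vec.replicate _ 0ℤ

lookup-⊞ : ∀ (x y : Vec ℤ D) i → lookup (x ⊞ y) i ≡ lookup x i + lookup y i
lookup-⊞ x y i = Vecₚ.lookup-zipWith _+_ i x y

lookup-⊡ : ∀ c (x : Vec ℤ D) i → lookup (c ⊡ x) i ≡ c * lookup x i
lookup-⊡ c x i = Vecₚ.lookup-map i (c *_) x

lookup-ext : {x y : Vec ℤ D} → (∀ i → lookup x i ≡ lookup y i) → x ≡ y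
lookup-ext {x = []}     {[]}     eq = refl
lookup-ext {x = _ ∷ _} {_ ∷ _} eq = cong₂ _∷_ (eq zero) (lookup-ext (eq ∘ suc))

lookup-0⃗ : ∀ i → lookup (0⃗ {D}) i ≡ 0ℤ
lookup-0⃗ i = Vecₚ.lookup-replicate i 0ℤ

⊡-assoc : ∀ a b (x : Vec ℤ D) → a ⊡ b ⊡ x ≡ (a * b) ⊡ x
⊡-assoc a b []      = refl
⊡-assoc a b (x ∷ v) = cong₂ _∷_ (sym (ℤₚ.*-assoc a b x)) (⊡-assoc a b v)

⊡-identity : ∀ (x : Vec ℤ D) → 1ℤ ⊡ x ≡ x
⊡-identity []      = refl
⊡-identity (x ∷ v) = cong₂ _∷_ (ℤₚ.*-identityˡ x) (⊡-identity v)

⊡-distribˡ : ∀ c (x y : Vec ℤ D) → c ⊡ (x ⊞ y) ≡ c ⊡ x ⊞ c ⊡ y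
⊡-distribˡ c []      []      = refl
⊡-distribˡ c (x ∷ v) (y ∷ w) = cong₂ _∷_ (ℤₚ.*-distribˡ-+ c x y) (⊡-distribˡ c v w)

⊡-zero : ∀ (x : Vec ℤ D) → 0ℤ ⊡ x ≡ 0⃗
⊡-zero []      = refl
⊡-zero (x ∷ v) = cong (0ℤ ∷_) (⊡-zero v)

-- Functionals and maps are functions with proofs of linearity, not arrays of coefficients:
-- composites compute by definition, and `basis-induction` takes the place of coordinate expansions.
record Functional (D : ℕ) : Set where
  field
    ap   : Vec ℤ D → ℤ
    ap-⊞ : ∀ x y → ap (x ⊞ y) ≡ ap x + ap y
    ap-⊡ : ∀ c x → ap (c ⊡ x) ≡ c * ap x
open Functional public

record Map (D E : ℕ) : Set where
  field
    app   : Vec ℤ D → Vec ℤ E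
    app-⊞ : ∀ x y → app (x ⊞ y) ≡ app x ⊞ app y
    app-⊡ : ∀ c x → app (c ⊡ x) ≡ c ⊡ app x
open Map public

idᴹ : Map D D
idᴹ = record { app = λ x → x ; app-⊞ = λ _ _ → refl ; app-⊡ = λ _ _ → refl }

_∘ᴹ_ : Map E F → Map D E → Map D F
K ∘ᴹ L = record
  { app   = app K ∘ app L
  ; app-⊞ = λ x y → trans (cong (app K) (app-⊞ L x y)) (app-⊞ K _ _)
  ; app-⊡ = λ c x → trans (cong (app K) (app-⊡ L c x)) (app-⊡ K c _)
  }

_∘ᶠ_ : Functional E → Map D E → Functional D
f ∘ᶠ K = record
  { ap   = ap f ∘ app K
  ; ap-⊞ = λ x y → trans (cong (ap f) (app-⊞ K x y)) (ap-⊞ f _ _)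
  ; ap-⊡ = λ c x → trans (cong (ap f) (app-⊡ K c x)) (ap-⊡ f c _)
  }

scaleᴹ : ℤ → Map D D
scaleᴹ a = record
  { app   = a ⊡_
  ; app-⊞ = ⊡-distribˡ a
  ; app-⊡ = λ c x → trans (⊡-assoc a c x) (trans (cong (_⊡ x) (ℤₚ.*-comm a c)) (sym (⊡-assoc c a x)))
  }

coordinate : Fin D → Functional D
coordinate i = record { ap = λ x → lookup x i ; ap-⊞ = λ x y → lookup-⊞ x y i ; ap-⊡ = λ c x → lookup-⊡ c x i }

ap-0⃗ : (f : Functional D) → ap f 0⃗ ≡ 0ℤ
ap-0⃗ f = trans (cong (ap f) (sym (⊡-zero 0⃗))) (ap-⊡ f 0ℤ 0⃗)

ap-lin : ∀ (f : Functional D) a x b y → ap f (a ⊡ x ⊞ b ⊡ y) ≡ a * ap f x + b * ap f y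
ap-lin f a x b y = trans (ap-⊞ f _ _) (cong₂ _+_ (ap-⊡ f a x) (ap-⊡ f b y))

Closed : (Vec ℤ D → Set) → Set
Closed Z = ∀ a x b y → Z x → Z y → Z (a ⊡ x ⊞ b ⊡ y)

closed-⊡ : {Z : Vec ℤ D → Set} → Closed Z → ∀ a x → Z x → Z (a ⊡ x)
closed-⊡ {Z = Z} cl a x Zx = subst Z eq (cl a x 0ℤ x Zx Zx)
  where
  alg : ∀ a x → a * x + 0ℤ * x ≡ a * x
  alg = solve-∀
  eq : a ⊡ x ⊞ 0ℤ ⊡ x ≡ a ⊡ x
  eq = lookup-ext λ i → trans (lookup-⊞ (a ⊡ x) _ i) (trans (cong₂ _+_ (lookup-⊡ a x i) (lookup-⊡ 0ℤ x i))
         (trans (alg a (lookup x i)) (sym (lookup-⊡ a x i))))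

closed-⊞ : {Z : Vec ℤ D → Set} → Closed Z → ∀ x y → Z x → Z y → Z (x ⊞ y)
closed-⊞ {Z = Z} cl x y Zx Zy = subst Z (cong₂ _⊞_ (⊡-identity x) (⊡-identity y)) (cl 1ℤ x 1ℤ y Zx Zy)

image : (Vec ℤ D → Set) → Map D E → Vec ℤ E → Set
image Z K z = ∃ λ x → Z x × z ≡ app K x

image-closed : ∀ {Z : Vec ℤ D → Set} (K : Map D E) → Closed Z → Closed (image Z K)
image-closed K cl a _ b _ (x , Zx , refl) (y , Zy , refl) =
  a ⊡ x ⊞ b ⊡ y , cl a x b y Zx Zy , sym (trans (app-⊞ K _ _) (cong₂ _⊞_ (app-⊡ K a x) (app-⊡ K b y)))

e : Fin D → Vec ℤ D
e zero    = 1ℤ ∷ 0⃗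
e (suc i) = 0ℤ ∷ e i

basis-induction : (Z : Vec ℤ D → Set) → Closed Z → Z 0⃗ → (∀ i → Z (e i)) → ∀ x → Z x
basis-induction {zero}  Z cl z0 ze []      = z0
basis-induction {suc D} Z cl z0 ze (x ∷ v) = subst Z (cong₂ _∷_ (head x) (tail v))
  (cl x (e zero) 1ℤ (0ℤ ∷ v) (ze zero)
    (basis-induction (Z ∘ (0ℤ ∷_)) cl′ z0 (ze ∘ suc) v))
  where
  head : ∀ x → x * 1ℤ + 1ℤ * 0ℤ ≡ x
  head = solve-∀
  tail-alg : ∀ x v → x * 0ℤ + 1ℤ * v ≡ v
  tail-alg = solve-∀
  tail : ∀ v → x ⊡ 0⃗ ⊞ 1ℤ ⊡ v ≡ v
  tail v = lookup-ext λ i → trans (lookup-⊞ (x ⊡ 0⃗) _ i) (trans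
    (cong₂ _+_ (trans (lookup-⊡ x 0⃗ i) (cong (x *_) (lookup-0⃗ i))) (lookup-⊡ 1ℤ v i)) (tail-alg x (lookup v i)))
  cl′ : Closed (Z ∘ (0ℤ ∷_))
  cl′ a u b w Zu Zw = subst Z (cong (_∷ (a ⊡ u ⊞ b ⊡ w)) (alg a b)) (cl a (0ℤ ∷ u) b (0ℤ ∷ w) Zu Zw)
    where
    alg : ∀ a b → a * 0ℤ + b * 0ℤ ≡ 0ℤ
    alg = solve-∀

Kills : Functional D → List (Vec ℤ D) → Set
Kills f = All (λ g → ap f g ≡ 0ℤ)

kernel-closed : (f : Functional D) → Closed (λ x → ap f x ≡ 0ℤ)
kernel-closed f a x b y fx fy = trans (ap-lin f a x b y)
  (trans (cong₂ _+_ (trans (cong (a *_) fx) (ℤₚ.*-zeroʳ a)) (trans (cong (b *_) fy) (ℤₚ.*-zeroʳ b))) refl)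

-- A subspace known both by generators and by equations. Completeness is phrased dually: over ℤ the
-- generators only span the subspace up to nonzero multiples, which functionals do not see.
record Subspace (D : ℕ) : Set where
  field
    gens     : List (Vec ℤ D)
    eqns     : List (Functional D)
    sound    : All (λ g → All (λ h → ap h g ≡ 0ℤ) eqns) gens
    complete : ∀ x → All (λ h → ap h x ≡ 0ℤ) eqns → ∀ f → Kills f gens → ap f x ≡ 0ℤ
open Subspace public

infix 4 _∈ₛ_
_∈ₛ_ : Vec ℤ D → Subspace D → Set
x ∈ₛ W = All (λ h → ap h x ≡ 0ℤ) (eqns W)

_∈ₛ?_ : ∀ (x : Vec ℤ D) W → Dec (x ∈ₛ W)
x ∈ₛ? W = All.all? (λ h → ap h x ℤ.≟ 0ℤ) (eqns W)

∈ₛ-closed : (W : Subspace D) → Closed (_∈ₛ W)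
∈ₛ-closed W a x b y Wx Wy = All.zipWith (λ {h} (hx , hy) → kernel-closed h a x b y hx hy) (Wx , Wy)

size : Subspace D → ℕ
size W = length (gens W)

vanishes? : ∀ (f : Functional D) gs → Kills f gs ⊎ Any (λ g → ap f g ≢ 0ℤ) gs
vanishes? f gs with All.all? (λ g → ap f g ℤ.≟ 0ℤ) gs
... | yes k = inj₁ k
... | no ¬k = inj₂ (Allₚ.¬All⇒Any¬ (λ g → ap f g ℤ.≟ 0ℤ) gs ¬k)

nonzero-generator : ∀ (W : Subspace D) f x → x ∈ₛ W → ap f x ≢ 0ℤ → Any (λ g → ap f g ≢ 0ℤ) (gens W)
nonzero-generator W f x Wx fx≢0 with vanishes? f (gens W)
... | inj₁ k = contradiction (complete W x Wx f k) fx≢0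
... | inj₂ a = a

whole : Subspace D
whole {D} = record
  { gens = List.tabulate e ; eqns = [] ; sound = All.universal (λ _ → []) _
  ; complete = λ x _ f k → basis-induction (λ x → ap f x ≡ 0ℤ) (kernel-closed f) (ap-0⃗ f) (Allₚ.tabulate⁻ k) x }

size-whole : size (whole {D}) ≡ D
size-whole = Listₚ.length-tabulate e

abstract
  -- Fraction-free elimination with pivot `g`: the other generators are pushed into the kernel of
  -- `ℓ` by subtracting multiples of `g`. For completeness, a functional `f` killing the new
  -- generators is traded for `dual f`, which kills the old ones and on the kernel of `ℓ` is the
  -- nonzero multiple `ap ℓ g` of `f`.
  refine : ∀ (W : Subspace D) ℓ → Any (λ g → ap ℓ g ≢ 0ℤ) (gens W) →
           ∃ λ W′ → suc (size W′) ≡ size W × eqns W′ ≡ ℓ ∷ eqns W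
  refine {D} W ℓ nz with g , g∈ , ℓg≢0 ← find nz with as , bs , eq ← ∈-∃++ g∈ =
    record
      { gens     = List.map elim (as ++ bs)
      ; eqns     = ℓ ∷ eqns W
      ; sound    = Allₚ.map⁺ (All.map (λ {x} hx → elim-ℓ x ∷ ∈ₛ-closed W (ap ℓ g) x (- ap ℓ x) g hx gW) sound′)
      ; complete = λ x hx f k → cancel-≢0 ℓg≢0 (trans (sym (dual-zero f x (All.head hx)))
                     (complete W x (All.tail hx) (dual f) (subst (Kills (dual f)) (sym eq) (dual-kills f (Allₚ.map⁻ k)))))
      } , trans (cong suc (trans (Listₚ.length-map elim (as ++ bs)) (Listₚ.length-++ as)))
            (trans (sym (ℕₚ.+-suc (length as) (length bs)))
              (sym (trans (cong length eq) (Listₚ.length-++ as)))) , refl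
    where
    elim : Vec ℤ D → Vec ℤ D
    elim x = ap ℓ g ⊡ x ⊞ (- ap ℓ x) ⊡ g
    elim-ℓ : ∀ x → ap ℓ (elim x) ≡ 0ℤ
    elim-ℓ x = trans (ap-lin ℓ (ap ℓ g) x (- ap ℓ x) g) (alg (ap ℓ g) (ap ℓ x))
      where
      alg : ∀ a b → a * b + - b * a ≡ 0ℤ
      alg = solve-∀
    all′ : All (_∈ₛ W) (as ++ g ∷ bs)
    all′ = subst (All (_∈ₛ W)) eq (sound W)
    gW : g ∈ₛ W
    gW = All.head (Allₚ.++⁻ʳ as all′)
    sound′ : All (_∈ₛ W) (as ++ bs)
    sound′ = Allₚ.++⁺ (Allₚ.++⁻ˡ as all′) (All.tail (Allₚ.++⁻ʳ as all′))
    dual : Functional D → Functional D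
    dual f = record
      { ap   = λ x → ap ℓ g * ap f x - ap f g * ap ℓ x
      ; ap-⊞ = λ x y → trans (cong₂ (λ s t → ap ℓ g * s - ap f g * t) (ap-⊞ f x y) (ap-⊞ ℓ x y))
                             (alg₁ (ap ℓ g) (ap f g) (ap f x) (ap f y) (ap ℓ x) (ap ℓ y))
      ; ap-⊡ = λ c x → trans (cong₂ (λ s t → ap ℓ g * s - ap f g * t) (ap-⊡ f c x) (ap-⊡ ℓ c x))
                             (alg₂ (ap ℓ g) (ap f g) c (ap f x) (ap ℓ x))
      }
      where
      alg₁ : ∀ a b x y u v → a * (x + y) - b * (u + v) ≡ a * x - b * u + (a * y - b * v)
      alg₁ = solve-∀
      alg₂ : ∀ a b c x u → a * (c * x) - b * (c * u) ≡ c * (a * x - b * u)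
      alg₂ = solve-∀
    dual-zero : ∀ f x → ap ℓ x ≡ 0ℤ → ap (dual f) x ≡ ap ℓ g * ap f x
    dual-zero f x ℓx = trans (cong (λ t → ap ℓ g * ap f x - ap f g * t) ℓx) (alg (ap ℓ g * ap f x) (ap f g))
      where
      alg : ∀ a b → a - b * 0ℤ ≡ a
      alg = solve-∀
    dual-elim : ∀ f x → ap f (elim x) ≡ 0ℤ → ap (dual f) x ≡ 0ℤ
    dual-elim f x k = trans (alg (ap ℓ g) (ap f x) (ap f g) (ap ℓ x))
                            (trans (sym (ap-lin f (ap ℓ g) x (- ap ℓ x) g)) k)
      where
      alg : ∀ a b c d → a * b - c * d ≡ a * b + - d * c
      alg = solve-∀
    dual-kills : ∀ f → All (λ x → ap f (elim x) ≡ 0ℤ) (as ++ bs) → Kills (dual f) (as ++ g ∷ bs)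
    dual-kills f k = Allₚ.++⁺ (All.map (λ {x} → dual-elim f x) (Allₚ.++⁻ˡ as k))
      (alg (ap ℓ g) (ap f g) ∷ All.map (λ {x} → dual-elim f x) (Allₚ.++⁻ʳ as k))
      where
      alg : ∀ a b → a * b - b * a ≡ 0ℤ
      alg = solve-∀

-- Linear independence is certified by functionals that are triangular on the vectors.
Family : ℕ → Set
Family D = List (Vec ℤ D × Functional D)

data Independent {D} : Family D → Set where
  []  : Independent []
  add : ∀ {v f ps} → ap f v ≢ 0ℤ → All (λ q → ap (proj₂ q) v ≡ 0ℤ) ps → Independent ps → Independent ((v , f) ∷ ps)

-- Kernels are intersected starting from the tail. The next vector is killed by the functionals of
-- the tail, hence lies in the kernel so far, while its own functional is nonzero on it; so each
-- refinement drops exactly one generator.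
family-kernel : ∀ {ps : Family D} → Independent ps →
                ∃ λ W → size W ℕ.+ length ps ≡ D × eqns W ≡ List.map proj₂ ps
family-kernel [] = whole , trans (ℕₚ.+-identityʳ _) size-whole , refl
family-kernel (add {v} {f} {ps} fv≢0 ks ind) with W , eq , eqs ← family-kernel ind
  with W′ , eq′ , eqs′ ← refine W f (nonzero-generator W f v (subst (All (λ h → ap h v ≡ 0ℤ)) (sym eqs) (Allₚ.map⁺ ks)) fv≢0) =
    W′ , trans (ℕₚ.+-suc (size W′) (length ps)) (trans (cong (ℕ._+ length ps) eq′) eq) ,
    trans eqs′ (cong (f ∷_) eqs)

independent-length : ∀ {ps : Family D} → Independent ps → length ps ℕ.≤ D
independent-length {ps = ps} ind with W , eq , _ ← family-kernel ind =
  ℕₚ.≤-trans (ℕₚ.m≤n+m (length ps) (size W)) (ℕₚ.≤-reflexive eq)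

-- Gaussian elimination of `x` against the family; triangularity keeps the zeros already obtained.
-- Instead of listing coefficients, the correction is described by its lying in any closed `Z` that
-- contains 0 and the vectors of the family.
reduce : ∀ {ps : Family D} → Independent ps → ∀ x → ∃₂ λ c y → c ≢ 0ℤ × All (λ q → ap (proj₂ q) y ≡ 0ℤ) ps ×
         (∀ {Z} → Closed Z → Z 0⃗ → All (Z ∘ proj₁) ps → ∃ λ z → Z z × y ≡ c ⊡ x ⊞ z)
reduce [] x = 1ℤ , x , (λ ()) , [] , λ cl z0 _ → 0⃗ , z0 , lookup-ext λ i →
  sym (trans (lookup-⊞ (1ℤ ⊡ x) 0⃗ i) (trans (cong₂ _+_ (lookup-⊡ 1ℤ x i) (lookup-0⃗ i)) (alg (lookup x i))))
  where
  alg : ∀ x → 1ℤ * x + 0ℤ ≡ x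
  alg = solve-∀
reduce {D} (add {v} {f} {ps} fv≢0 ks ind) x with c , y , c≢0 , ky , dec ← reduce ind x =
  ap f v * c , y′ , ≢0-* fv≢0 c≢0 ,
  (trans (ap-lin f (ap f v) y (- ap f y) v) (alg₁ (ap f v) (ap f y)) ∷
     All.zipWith (λ {q} (a , b) → kernel-closed (proj₂ q) (ap f v) y (- ap f y) v a b) (ky , ks)) ,
  decompose
  where
  y′ : Vec ℤ D
  y′ = ap f v ⊡ y ⊞ (- ap f y) ⊡ v
  alg₁ : ∀ a b → a * b + - b * a ≡ 0ℤ
  alg₁ = solve-∀
  alg₂ : ∀ a c x z b v → a * (c * x + z) + b * v ≡ a * c * x + (a * z + b * v)
  alg₂ = solve-∀
  decompose : ∀ {Z} → Closed Z → Z 0⃗ → All (Z ∘ proj₁) ((v , f) ∷ ps) → ∃ λ z → Z z × y′ ≡ (ap f v * c) ⊡ x ⊞ z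
  decompose cl z0 (Zv ∷ Zs) with z , Zz , eq ← dec cl z0 Zs =
    ap f v ⊡ z ⊞ (- ap f y) ⊡ v , cl (ap f v) z (- ap f y) v Zz Zv ,
    trans (cong (λ h → ap f v ⊡ h ⊞ (- ap f y) ⊡ v) eq) (regroup (ap f v) c x z (- ap f y) v)
    where
    regroup : ∀ {D} a c (x z : Vec ℤ D) b v → a ⊡ (c ⊡ x ⊞ z) ⊞ b ⊡ v ≡ (a * c) ⊡ x ⊞ (a ⊡ z ⊞ b ⊡ v)
    regroup a c []      []      b []      = refl
    regroup a c (x ∷ u) (z ∷ w) b (v ∷ t) = cong₂ _∷_ (alg₂ a c x z b v) (regroup a c u w b t)

nonzero-coordinate : (x : Vec ℤ D) → x ≢ 0⃗ → ∃ λ i → lookup x i ≢ 0ℤ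
nonzero-coordinate []      x≢0 = contradiction refl x≢0
nonzero-coordinate (a ∷ x) x≢0 with a ℤ.≟ 0ℤ
... | no a≢0 = zero , a≢0
... | yes refl with i , ne ← nonzero-coordinate x (x≢0 ∘ cong (0ℤ ∷_)) = suc i , ne

_≟ⱽ_ : (x y : Vec ℤ D) → Dec (x ≡ y)
_≟ⱽ_ = Vecₚ.≡-dec ℤ._≟_

-- Eliminate `x` against the family. A zero remainder puts a nonzero multiple of `x` into `S`; a
-- nonzero one lies in `T`, is killed by the old functionals, and is certified by any coordinate at
-- which it does not vanish.
extend : ∀ {ps : Family D} → Independent ps → ∀ {S T : Vec ℤ D → Set} → Closed S → S 0⃗ → All (S ∘ proj₁) ps →
         Closed T → (∀ {z} → S z → T z) → ∀ x → T x →
         (∃ λ c → c ≢ 0ℤ × S (c ⊡ x)) ⊎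
         (∃ λ ps′ → Independent ps′ × All (T ∘ proj₁) ps′ × length ps′ ≡ suc (length ps))
extend {ps = ps} ind {S} {T} clS S0 Sps clT S⊆T x Tx with c , y , c≢0 , ky , dec ← reduce ind x
  with z , Sz , y≡ ← dec clS S0 Sps with y ≟ⱽ 0⃗
... | yes refl = inj₁ (c , c≢0 , subst S (neg _ z y≡) (closed-⊡ clS -1ℤ z Sz))
  where
  neg : ∀ {D} (u z : Vec ℤ D) → 0⃗ ≡ u ⊞ z → -1ℤ ⊡ z ≡ u
  neg u z eq = lookup-ext λ i → trans (lookup-⊡ -1ℤ z i) (trans (alg (lookup u i) (lookup z i))
    (trans (cong (λ h → lookup u i - h) (trans (sym (lookup-⊞ u z i)) (trans (cong (λ h → lookup h i) (sym eq)) (lookup-0⃗ i))))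
      (ℤₚ.+-identityʳ _)))
    where
    alg : ∀ u z → -1ℤ * z ≡ u - (u + z)
    alg = solve-∀
... | no y≢0 with i , yi≢0 ← nonzero-coordinate y y≢0 =
  inj₂ ((y , coordinate i) ∷ ps , add yi≢0 ky ind ,
    subst T (sym y≡) (closed-⊞ clT _ z (closed-⊡ clT c x Tx) (S⊆T Sz)) ∷ All.map S⊆T Sps , refl)

-- Preimages are certified by the old functionals composed with `K`. The last component strengthens
-- the induction: it carries triangularity over from the images.
pull-back-kill : ∀ (K : Map D E) {Z} {ps : Family E} → Independent ps → All (image Z K ∘ proj₁) ps →
            ∃ λ ps′ → Independent ps′ × All (Z ∘ proj₁) ps′ × length ps′ ≡ length ps ×
              (∀ x → All (λ q → ap (proj₂ q) (app K x) ≡ 0ℤ) ps → All (λ q → ap (proj₂ q) x ≡ 0ℤ) ps′)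
pull-back-kill K [] [] = [] , [] , [] , refl , λ _ _ → []
pull-back-kill K (add {f = f} fv≢0 ks ind) ((x , Zx , refl) ∷ im) with ps′ , ind′ , Zs , len , kill ← pull-back-kill K ind im =
  (x , f ∘ᶠ K) ∷ ps′ , add fv≢0 (kill x ks) ind′ , Zx ∷ Zs , cong suc len ,
  λ y ky → All.head ky ∷ kill y (All.tail ky)

pull-back : ∀ (K : Map D E) {Z} {ps : Family E} → Independent ps → All (image Z K ∘ proj₁) ps →
            ∃ λ ps′ → Independent ps′ × All (Z ∘ proj₁) ps′ × length ps′ ≡ length ps
pull-back K ind im with ps′ , ind′ , Zs , len , _ ← pull-back-kill K ind im = ps′ , ind′ , Zs , len

-- The Skolem–Mahler–Lech theorem for one linear map

iter : Map D D → ℕ → Map D D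
iter A zero    = idᴹ
iter A (suc k) = iter A k ∘ᴹ A

iter-+ : ∀ (A : Map D D) j k x → app (iter A (j ℕ.+ k)) x ≡ app (iter A k) (app (iter A j) x)
iter-+ A zero    k x = refl
iter-+ A (suc j) k x = iter-+ A j k (app A x)

iter-comm : ∀ (A : Map D D) j k x → app (iter A j) (app (iter A k) x) ≡ app (iter A k) (app (iter A j) x)
iter-comm A j k x = trans (sym (iter-+ A k j x)) (trans (cong (λ m → app (iter A m) x) (ℕₚ.+-comm k j)) (iter-+ A j k x))

app-0⃗ : (K : Map D E) → app K 0⃗ ≡ 0⃗
app-0⃗ K = trans (cong (app K) (sym (⊡-zero 0⃗))) (trans (app-⊡ K 0ℤ 0⃗) (⊡-zero _))

preimage-closed : {S : Vec ℤ E → Set} (K : Map D E) → Closed S → Closed (S ∘ app K)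
preimage-closed {S = S} K cl a x b y Sx Sy = subst S
  (sym (trans (app-⊞ K (a ⊡ x) (b ⊡ y)) (cong₂ _⊞_ (app-⊡ K a x) (app-⊡ K b y)))) (cl a (app K x) b (app K y) Sx Sy)

all-or-some : ∀ m {P : Fin m → Set} {Q : Set} → (∀ i → P i ⊎ Q) → (∀ i → P i) ⊎ Q
all-or-some zero    pq = inj₁ λ ()
all-or-some (suc m) pq with pq zero
... | inj₂ q = inj₂ q
... | inj₁ p with all-or-some m (pq ∘ suc)
...   | inj₁ ps = inj₁ λ { zero → p ; (suc i) → ps i }
...   | inj₂ q  = inj₂ q

common-multiple : ∀ m {S : Vec ℤ D → Set} → Closed S → (v : Fin m → Vec ℤ D) →
                  (∀ i → ∃ λ c → c ≢ 0ℤ × S (c ⊡ v i)) → ∃ λ g → g ≢ 0ℤ × ∀ i → S (g ⊡ v i)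
common-multiple zero        cl v h = 1ℤ , (λ ()) , λ ()
common-multiple (suc m) {S} cl v h with c , c≢0 , Sc ← h zero | g , g≢0 , Sg ← common-multiple m cl (v ∘ suc) (h ∘ suc) =
  c * g , ≢0-* c≢0 g≢0 , λ
    { zero    → subst S (trans (⊡-assoc g c (v zero)) (cong (_⊡ v zero) (ℤₚ.*-comm g c))) (closed-⊡ cl g _ Sc)
    ; (suc i) → subst S (⊡-assoc c g (v (suc i))) (closed-⊡ cl c _ (Sg i)) }

Range : Map D E → Vec ℤ E → Set
Range K = image (λ _ → ⊤) K

range-closed : (K : Map D E) → Closed (Range K)
range-closed K = image-closed K (λ _ _ _ _ _ _ → tt)

range-0⃗ : (K : Map D E) → Range K 0⃗
range-0⃗ K = 0⃗ , tt , sym (app-0⃗ K)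

-- Over ℤ the ranges of the powers may shrink forever while only their ranks stabilise, so stability
-- is required up to one factor `g`.
StableFrom : Map D D → ℕ → ℤ → Set
StableFrom A J g = ∀ x → Range (iter A (suc J)) (g ⊡ app (iter A J) x)

abstract
  -- Descend from `J = D` with a family of `D - J` independent vectors in the range of `A^(J+1)`. If
  -- `A^J` contributes nothing new, `J` is stable; otherwise the family grows by one and `J` drops.
  -- At `J = 0` growth would give `D + 1` independent vectors.
  stabilise : ∀ (A : Map D D) J {ps} → Independent ps → All (Range (iter A (suc J)) ∘ proj₁) ps → length ps ℕ.+ J ≡ D →
              ∃₂ λ J g → g ≢ 0ℤ × StableFrom A J g
  stabilise {D} A J {ps} ind rs len with all-or-some D (λ i → extend ind (range-closed (iter A (suc J))) (range-0⃗ (iter A (suc J)))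
    rs (range-closed (iter A J)) (λ (x , _ , eq) → app A x , tt , eq) (app (iter A J) (e i)) (e i , tt , refl))
  ... | inj₁ h with g , g≢0 , gs ← common-multiple D (range-closed (iter A (suc J))) (app (iter A J) ∘ e) h =
    J , g , g≢0 , basis-induction _ (preimage-closed (scaleᴹ g ∘ᴹ iter A J) (range-closed (iter A (suc J))))
      (subst (Range (iter A (suc J))) (sym (app-0⃗ (scaleᴹ g ∘ᴹ iter A J))) (range-0⃗ (iter A (suc J)))) gs
  stabilise A zero ind rs len | inj₂ (ps′ , ind′ , _ , len′) =
    contradiction (ℕₚ.≤-reflexive (trans (cong suc (trans (sym len) (ℕₚ.+-identityʳ _))) (sym len′)))
                  (ℕₚ.≤⇒≯ (independent-length ind′))
  stabilise A (suc J) ind rs len | inj₂ (ps′ , ind′ , rs′ , len′) =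
    stabilise A J ind′ rs′ (trans (cong (ℕ._+ J) len′) (trans (sym (ℕₚ.+-suc _ J)) len))

-- A modulus prime to g for free: up to a multiple of g that is 1 modulo (|g| + 1)², A is invertible on its
-- stable range.
unit-multiple : ∀ g → ∃ λ m → m * g ≡ 1ℤ - + suc ∣ g ∣ * + suc ∣ g ∣
unit-multiple (+ n)    = - (+ 2 + + n) , alg (+ n)
  where
  alg : ∀ n → - (+ 2 + n) * n ≡ 1ℤ - (1ℤ + n) * (1ℤ + n)
  alg = solve-∀
unit-multiple -[1+ n ] = + 2 + + suc n , alg (+ suc n)
  where
  alg : ∀ n → (+ 2 + n) * - n ≡ 1ℤ - (1ℤ + n) * (1ℤ + n)
  alg = solve-∀

-- Each use of stability trades a factor `γ` for one more application of `A`.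
lift-power : ∀ (A : Map D D) J γ → StableFrom A J γ →
             ∀ a x → ∃ λ y → (γ ℤ.^ a) ⊡ app (iter A J) x ≡ app (iter A J) (app (iter A a) y)
lift-power A J γ st zero    x = x , ⊡-identity _
lift-power A J γ st (suc a) x with y , eq ← lift-power A J γ st a x with y′ , _ , eq′ ← st y = y′ , (begin
  (γ * γ ℤ.^ a) ⊡ app (iter A J) x         ≡⟨ sym (⊡-assoc γ (γ ℤ.^ a) _) ⟩
  γ ⊡ (γ ℤ.^ a) ⊡ app (iter A J) x         ≡⟨ cong (γ ⊡_) eq ⟩
  γ ⊡ app (iter A J) (app (iter A a) y)    ≡⟨ cong (γ ⊡_) (iter-comm A J a y) ⟩
  γ ⊡ app (iter A a) (app (iter A J) y)    ≡⟨ sym (app-⊡ (iter A a) γ _) ⟩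
  app (iter A a) (γ ⊡ app (iter A J) y)    ≡⟨ cong (app (iter A a)) eq′ ⟩
  app (iter A a) (app (iter A J) (app A y′)) ≡⟨ iter-comm A a J (app A y′) ⟩
  app (iter A J) (app (iter A a) (app A y′)) ∎)
  where open ≡-Reasoning

module _ (A : Map D D) (P : ℕ) .{{_ : ℕ.NonZero P}} where

  residue : ℕ → Fin D → Fin D → Fin P
  residue k i j = fromℕ< (n%ℕd<d (lookup (app (iter A k) (e i)) j) P)

  -- The matrix of the `k`-th power modulo `P` as one element of a finite set, ready for the
  -- pigeonhole principle in `period`.
  code : ℕ → Fin ((P ℕ.^ D) ℕ.^ D)
  code k = Fin.funToFin (λ i → Fin.funToFin (residue k i))

  code-injective : ∀ {k l} → code k ≡ code l → ∀ i j → residue k i j ≡ residue l i j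
  code-injective {k} {l} eq i j = trans (sym (Finₚ.finToFun-funToFin (residue k i) j)) (trans (cong (λ c → Fin.finToFun c j)
    (trans (sym (Finₚ.finToFun-funToFin (λ i → Fin.funToFin (residue k i)) i))
      (trans (cong (λ c → Fin.finToFun c i) eq) (Finₚ.finToFun-funToFin (λ i → Fin.funToFin (residue l i)) i))))
    (Finₚ.finToFun-funToFin (residue l i) j))

  Congruent : ℕ → ℕ → Vec ℤ D → Set
  Congruent k l x = ∃ λ y → app (iter A k) x ≡ app (iter A l) x ⊞ + P ⊡ y

  congruent-closed : ∀ k l → Closed (Congruent k l)
  congruent-closed k l a x b x′ (y , eq) (y′ , eq′) = a ⊡ y ⊞ b ⊡ y′ , (begin
    app (iter A k) (a ⊡ x ⊞ b ⊡ x′)                                    ≡⟨ lin (iter A k) ⟩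
    a ⊡ app (iter A k) x ⊞ b ⊡ app (iter A k) x′                       ≡⟨ cong₂ (λ u v → a ⊡ u ⊞ b ⊡ v) eq eq′ ⟩
    a ⊡ (app (iter A l) x ⊞ + P ⊡ y) ⊞ b ⊡ (app (iter A l) x′ ⊞ + P ⊡ y′) ≡⟨ regroup (app (iter A l) x) (app (iter A l) x′) y y′ ⟩
    (a ⊡ app (iter A l) x ⊞ b ⊡ app (iter A l) x′) ⊞ + P ⊡ (a ⊡ y ⊞ b ⊡ y′) ≡⟨ cong (_⊞ + P ⊡ (a ⊡ y ⊞ b ⊡ y′)) (sym (lin (iter A l))) ⟩
    app (iter A l) (a ⊡ x ⊞ b ⊡ x′) ⊞ + P ⊡ (a ⊡ y ⊞ b ⊡ y′)           ∎)
    where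
    open ≡-Reasoning
    lin : (K : Map D D) → app K (a ⊡ x ⊞ b ⊡ x′) ≡ a ⊡ app K x ⊞ b ⊡ app K x′
    lin K = trans (app-⊞ K (a ⊡ x) (b ⊡ x′)) (cong₂ _⊞_ (app-⊡ K a x) (app-⊡ K b x′))
    alg : ∀ a b P u u′ y y′ → a * (u + P * y) + b * (u′ + P * y′) ≡ a * u + b * u′ + P * (a * y + b * y′)
    alg = solve-∀
    regroup : ∀ {D} (u u′ y y′ : Vec ℤ D) →
              a ⊡ (u ⊞ + P ⊡ y) ⊞ b ⊡ (u′ ⊞ + P ⊡ y′) ≡ (a ⊡ u ⊞ b ⊡ u′) ⊞ + P ⊡ (a ⊡ y ⊞ b ⊡ y′)
    regroup []      []        []      []        = refl
    regroup (u ∷ w) (u′ ∷ w′) (y ∷ t) (y′ ∷ t′) = cong₂ _∷_ (alg a b (+ P) u u′ y y′) (regroup w w′ t t′)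

  congruent-0⃗ : ∀ k l → Congruent k l 0⃗
  congruent-0⃗ k l = 0⃗ , trans (app-0⃗ (iter A k)) (sym (trans (cong₂ _⊞_ (app-0⃗ (iter A l)) (app-0⃗ (scaleᴹ (+ P))))
    (lookup-ext λ i → trans (lookup-⊞ 0⃗ 0⃗ i) (trans (cong₂ _+_ (lookup-0⃗ {D} i) (lookup-0⃗ {D} i)) (sym (lookup-0⃗ {D} i))))))

  code≡⇒congruent : ∀ k l → code k ≡ code l → ∀ x → Congruent k l x
  code≡⇒congruent k l eq = basis-induction (Congruent k l) (congruent-closed k l) (congruent-0⃗ k l) λ i →
    tabulate (λ j → u k i j /ℕ P - u l i j /ℕ P) , lookup-ext λ j → begin
      u k i j                                                       ≡⟨ a≡a%ℕn+[a/ℕn]*n (u k i j) P ⟩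
      + (u k i j %ℕ P) + u k i j /ℕ P * + P                         ≡⟨ cong (λ r → + r + u k i j /ℕ P * + P) (res≡ i j) ⟩
      + (u l i j %ℕ P) + u k i j /ℕ P * + P                         ≡⟨ alg (+ (u l i j %ℕ P)) (u k i j /ℕ P) (u l i j /ℕ P) (+ P) ⟩
      (+ (u l i j %ℕ P) + u l i j /ℕ P * + P) + + P * (u k i j /ℕ P - u l i j /ℕ P)
        ≡⟨ cong (_+ + P * (u k i j /ℕ P - u l i j /ℕ P)) (sym (a≡a%ℕn+[a/ℕn]*n (u l i j) P)) ⟩
      u l i j + + P * (u k i j /ℕ P - u l i j /ℕ P)
        ≡⟨ cong (λ h → u l i j + + P * h) (sym (Vecₚ.lookup∘tabulate (λ j → u k i j /ℕ P - u l i j /ℕ P) j)) ⟩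
      u l i j + + P * lookup (tabulate (λ j → u k i j /ℕ P - u l i j /ℕ P)) j
        ≡⟨ cong (_+_ (u l i j)) (sym (lookup-⊡ (+ P) (tabulate (λ j → u k i j /ℕ P - u l i j /ℕ P)) j)) ⟩
      u l i j + lookup (+ P ⊡ tabulate (λ j → u k i j /ℕ P - u l i j /ℕ P)) j
        ≡⟨ sym (lookup-⊞ (app (iter A l) (e i)) _ j) ⟩
      lookup (app (iter A l) (e i) ⊞ + P ⊡ tabulate (λ j → u k i j /ℕ P - u l i j /ℕ P)) j ∎
    where
    open ≡-Reasoning
    u : ℕ → Fin D → Fin D → ℤ
    u k i j = lookup (app (iter A k) (e i)) j
    res≡ : ∀ i j → u k i j %ℕ P ≡ u l i j %ℕ P
    res≡ i j = trans (sym (Finₚ.toℕ-fromℕ< (n%ℕd<d (u k i j) P))) (trans (cong toℕ (code-injective {k} {l} eq i j)) (Finₚ.toℕ-fromℕ< (n%ℕd<d (u l i j) P)))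
    alg : ∀ r q q′ P → r + q * P ≡ r + q′ * P + P * (q - q′)
    alg = solve-∀

  abstract
    period : ∃₂ λ a R → ∀ x → Congruent (a ℕ.+ suc R) a x
    period with i , j , i<j , eq ← Finₚ.pigeonhole (ℕₚ.n<1+n _) (code ∘ toℕ) with R , eq′ ← ℕₚ.m≤n⇒∃[o]m+o≡n i<j =
      toℕ i , R , subst (λ k → ∀ x → Congruent k (toℕ i) x) (sym (trans (ℕₚ.+-suc (toℕ i) R) eq′))
        (code≡⇒congruent (toℕ j) (toℕ i) (sym eq))

power-of-unit : ∀ P a → ∃ λ x → (1ℤ - P) ℤ.^ a ≡ 1ℤ + P * x
power-of-unit P zero    = 0ℤ , sym (cong (_+_ 1ℤ) (ℤₚ.*-zeroʳ P))
power-of-unit P (suc a) with x , eq ← power-of-unit P a = x - 1ℤ - P * x , trans (cong ((1ℤ - P) *_) eq) (alg P x)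
  where
  alg : ∀ P x → (1ℤ - P) * (1ℤ + P * x) ≡ 1ℤ + P * (x - 1ℤ - P * x)
  alg = solve-∀

abstract
  prime-divisor : ∀ q → 1 ℕ.< q → ∃₂ λ p q′ → Prime p × q ≡ p ℕ.* q′
  prime-divisor q 1<q with PrimeFactorisation.factors (factorise q {{ℕ.>-nonZero (ℕₚ.<-trans (ℕ.s≤s ℕ.z≤n) 1<q)}})
                         | PrimeFactorisation.isFactorisation (factorise q {{ℕ.>-nonZero (ℕₚ.<-trans (ℕ.s≤s ℕ.z≤n) 1<q)}})
                         | PrimeFactorisation.factorsPrime (factorise q {{ℕ.>-nonZero (ℕₚ.<-trans (ℕ.s≤s ℕ.z≤n) 1<q)}})
  ... | []     | eq | _      = contradiction (sym eq) (ℕₚ.<⇒≢ 1<q)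
  ... | p ∷ ps | eq | pr ∷ _ = p , product ps , pr , eq

-- The error term is again in the range of `A^J`, so that the relation can be applied to it in turn.
UnipotentModulo : Map D D → ℕ → ℕ → ℤ → ℕ → Set
UnipotentModulo A J R G q = ∀ x → ∃ λ y →
  G ⊡ app (iter A R) (app (iter A J) x) ≡ app (iter A J) x ⊞ (+ q * + q) ⊡ app (iter A J) y

abstract
  -- Powers of `A` repeat modulo `P`, but only from exponent `a` on. Multiplying by `(1 - P)^a`
  -- writes `A^J x` as `A^(J+a) y₀`, to which the repetition applies, and this multiplier is itself
  -- 1 modulo `P`.
  unipotent : ∀ (A : Map D D) J g → StableFrom A J g → ∃₂ λ R G → UnipotentModulo A J (suc R) G (suc ∣ g ∣)
  unipotent {D} A J g st with m , mg ← unit-multiple g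
    with a , R , cong-aR ← period A (suc ∣ g ∣ ℕ.* suc ∣ g ∣)
    with x₀ , G≡ ← power-of-unit (+ suc ∣ g ∣ * + suc ∣ g ∣) a = R , G , go
    where
    open ≡-Reasoning
    P G : ℤ
    P = + suc ∣ g ∣ * + suc ∣ g ∣
    G = (1ℤ - P) ℤ.^ a
    st′ : StableFrom A J (1ℤ - P)
    st′ x = subst (Range (iter A (suc J))) (trans (⊡-assoc m g _) (cong (_⊡ app (iter A J) x) mg))
              (closed-⊡ (range-closed (iter A (suc J))) m _ (st x))
    regroup : ∀ {D} (u w : Vec ℤ D) → (1ℤ + P * x₀) ⊡ u ⊞ P ⊡ w ≡ u ⊞ P ⊡ (x₀ ⊡ u ⊞ w)
    regroup []      []      = refl
    regroup (u ∷ s) (w ∷ r) = cong₂ _∷_ (alg P x₀ u w) (regroup s r)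
      where
      alg : ∀ P x u w → (1ℤ + P * x) * u + P * w ≡ u + P * (x * u + w)
      alg = solve-∀
    go : UnipotentModulo A J (suc R) G (suc ∣ g ∣)
    go x with y₀ , eq₀ ← lift-power A J (1ℤ - P) st′ a x with y₁ , eq₁ ← cong-aR y₀ = x₀ ⊡ x ⊞ y₁ , (begin
      G ⊡ app (iter A (suc R)) (app (iter A J) x)            ≡⟨ sym (app-⊡ (iter A (suc R)) G _) ⟩
      app (iter A (suc R)) (G ⊡ app (iter A J) x)            ≡⟨ cong (app (iter A (suc R))) eq₀ ⟩
      app (iter A (suc R)) (app (iter A J) (app (iter A a) y₀)) ≡⟨ iter-comm A (suc R) J _ ⟩
      app (iter A J) (app (iter A (suc R)) (app (iter A a) y₀)) ≡⟨ cong (app (iter A J)) (sym (iter-+ A a (suc R) y₀)) ⟩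
      app (iter A J) (app (iter A (a ℕ.+ suc R)) y₀)         ≡⟨ cong (app (iter A J)) eq₁ ⟩
      app (iter A J) (app (iter A a) y₀ ⊞ P ⊡ y₁)            ≡⟨ app-⊞ (iter A J) _ _ ⟩
      app (iter A J) (app (iter A a) y₀) ⊞ app (iter A J) (P ⊡ y₁) ≡⟨ cong₂ _⊞_ (sym eq₀) (app-⊡ (iter A J) P y₁) ⟩
      G ⊡ app (iter A J) x ⊞ P ⊡ app (iter A J) y₁           ≡⟨ cong (λ h → h ⊡ app (iter A J) x ⊞ P ⊡ app (iter A J) y₁) G≡ ⟩
      (1ℤ + P * x₀) ⊡ app (iter A J) x ⊞ P ⊡ app (iter A J) y₁ ≡⟨ regroup (app (iter A J) x) (app (iter A J) y₁) ⟩
      app (iter A J) x ⊞ P ⊡ (x₀ ⊡ app (iter A J) x ⊞ app (iter A J) y₁)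
        ≡⟨ cong (λ h → app (iter A J) x ⊞ P ⊡ h) (sym (trans (app-⊞ (iter A J) _ _) (cong (_⊞ app (iter A J) y₁) (app-⊡ (iter A J) x₀ x)))) ⟩
      app (iter A J) x ⊞ P ⊡ app (iter A J) (x₀ ⊡ x ⊞ y₁)   ∎)

FewZeros : Map D D → ℕ → ℕ → Set
FewZeros {D} A J R = ∀ (ℓ : Functional D) z → ap ℓ (app (iter A J) z) ≢ 0ℤ →
  ∃ λ m → ¬ AtLeast m 0 (λ k → ap ℓ (app (iter (iter A R) k) (app (iter A J) z)) ≡ 0ℤ)

module _ (A : Map D D) (J R : ℕ) (G : ℤ) (q : ℕ) (uni : UnipotentModulo A J R G q) (ℓ : Functional D) (z : Vec ℤ D) where

  private
    open ≡-Reasoning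
    B : Map D D
    B = scaleᴹ G ∘ᴹ iter A R
    -- Successive error terms: `B - 1` sends `A^J` of one entry to `q²` times `A^J` of the next. The
    -- table `c` therefore has the differences required for Newton interpolation.
    zs : ℕ → Vec ℤ D
    zs zero    = z
    zs (suc i) = proj₁ (uni (zs i))
    c : ℕ → ℕ → ℤ
    c k i = ap ℓ (app (iter B k) (app (iter A J) (zs i)))

  orbit-step : ∀ k i → c (suc k) i ≡ c k i + + q * + q * c k (suc i)
  orbit-step k i = begin
    ap f (app B x)                                ≡⟨ cong (ap f) (proj₂ (uni (zs i))) ⟩
    ap f (x ⊞ (+ q * + q) ⊡ y)                    ≡⟨ ap-⊞ f x ((+ q * + q) ⊡ y) ⟩
    ap f x + ap f ((+ q * + q) ⊡ y)               ≡⟨ cong (_+_ (ap f x)) (ap-⊡ f (+ q * + q) y) ⟩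
    ap f x + + q * + q * ap f y                   ∎
    where
    f : Functional D
    f = ℓ ∘ᶠ iter B k
    x y : Vec ℤ D
    x = app (iter A J) (zs i)
    y = app (iter A J) (zs (suc i))

  orbit-scale : ∀ k x → app (iter B k) x ≡ (G ℤ.^ k) ⊡ app (iter (iter A R) k) x
  orbit-scale zero    x = sym (⊡-identity x)
  orbit-scale (suc k) x = begin
    app (iter B k) (G ⊡ x′)                     ≡⟨ app-⊡ (iter B k) G x′ ⟩
    G ⊡ app (iter B k) x′                       ≡⟨ cong (G ⊡_) (orbit-scale k x′) ⟩
    G ⊡ (G ℤ.^ k) ⊡ app (iter (iter A R) k) x′  ≡⟨ ⊡-assoc G (G ℤ.^ k) (app (iter (iter A R) k) x′) ⟩
    (G ℤ.^ suc k) ⊡ app (iter (iter A R) k) x′  ∎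
    where
    x′ : Vec ℤ D
    x′ = app (iter A R) x

  orbit-zero : ∀ k → ap ℓ (app (iter (iter A R) k) (app (iter A J) z)) ≡ 0ℤ → c k 0 ≡ 0ℤ
  orbit-zero k eq = begin
    c k 0                     ≡⟨ cong (ap ℓ) (orbit-scale k (app (iter A J) z)) ⟩
    ap ℓ ((G ℤ.^ k) ⊡ x)      ≡⟨ ap-⊡ ℓ (G ℤ.^ k) x ⟩
    G ℤ.^ k * ap ℓ x          ≡⟨ cong (G ℤ.^ k *_) eq ⟩
    G ℤ.^ k * 0ℤ              ≡⟨ ℤₚ.*-zeroʳ (G ℤ.^ k) ⟩
    0ℤ                        ∎
    where
    x : Vec ℤ D
    x = app (iter (iter A R) k) (app (iter A J) z)

  few-zeros : 1 ℕ.< q → ap ℓ (app (iter A J) z) ≢ 0ℤ →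
              ∃ λ m → ¬ AtLeast m 0 (λ k → ap ℓ (app (iter (iter A R) k) (app (iter A J) z)) ≡ 0ℤ)
  few-zeros 1<q ℓz≢0 = bound (prime-divisor q 1<q)
    where
    alg : ∀ p q → p * q * (p * q) ≡ p * p * (q * q)
    alg = solve-∀
    bound : (∃₂ λ p q′ → Prime p × q ≡ p ℕ.* q′) →
            ∃ λ m → ¬ AtLeast m 0 (λ k → ap ℓ (app (iter (iter A R) k) (app (iter A J) z)) ≡ 0ℤ)
    bound (p , q′ , pr , q≡) = ∣ c 0 0 ∣ , λ al → zeros-bounded pr (+ q′ * + q′) c c-step ℓz≢0
      (atLeast-map (λ k _ → k) (λ _ _ _ _ k<l → k<l) orbit-zero ∣ c 0 0 ∣ (λ _ _ le → le) al)
      where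
      P≡ : + q * + q ≡ + p * + p * (+ q′ * + q′)
      P≡ = trans (cong (λ h → h * h) (trans (cong +_ q≡) (ℤₚ.pos-* p q′))) (alg (+ p) (+ q′))
      c-step : ∀ k i → c (suc k) i ≡ c k i + + p * + p * (+ q′ * + q′) * c k (suc i)
      c-step k i = trans (orbit-step k i) (cong (λ h → c k i + h * c k (suc i)) P≡)

abstract
  skolem : (A : Map D D) → ∃₂ λ J R → FewZeros A J (suc R)
  skolem {D} A = conclude (stabilise A D {[]} [] [] refl)
    where
    few : ∀ J g → g ≢ 0ℤ → (∃₂ λ R G → UnipotentModulo A J (suc R) G (suc ∣ g ∣)) → ∃₂ λ J R → FewZeros A J (suc R)
    few J g g≢0 (R , G , uni) = J , R , λ ℓ z →
      -- The modulus `suc ∣ g ∣` exceeds 1 because `g` is nonzero, and so has a prime divisor.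
      few-zeros A J (suc R) G (suc ∣ g ∣) uni ℓ z (ℕ.s≤s (ℕₚ.n≢0⇒n>0 (g≢0 ∘ ℤₚ.∣i∣≡0⇒i≡0)))
    conclude : (∃₂ λ J g → g ≢ 0ℤ × StableFrom A J g) → ∃₂ λ J R → FewZeros A J (suc R)
    conclude (J , g , g≢0 , st) = few J g g≢0 (unipotent A J g st)

-- Integer linear systems driven by words

abstract
  repetition : ∀ m (f : ℕ → Fin m) → ∃₂ λ i j → i ℕ.< j × j ℕ.≤ m × f i ≡ f j
  repetition m f with i , j , i<j , eq ← Finₚ.pigeonhole (ℕₚ.n<1+n m) (f ∘ toℕ) =
    toℕ i , toℕ j , i<j , ℕ.s≤s⁻¹ (Finₚ.toℕ<n j) , eq

All-or-some : ∀ {A : Set} {P : A → Set} {Q : Set} {xs} → All (λ x → P x ⊎ Q) xs → All P xs ⊎ Q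
All-or-some []            = inj₁ []
All-or-some (inj₂ q ∷ _)  = inj₂ q
All-or-some (inj₁ p ∷ ps) = map₁ (p ∷_) (All-or-some ps)

finite-union : ∀ K {N} (P : Fin K → ℕ → Set) → (∀ j → ∃ λ m → ¬ AtLeast m N (P j)) →
               ∃ λ m → ¬ AtLeast m N (λ i → ∃ λ j → P j i)
finite-union zero    P h = 1 , λ { (_ , _ , (() , _) , _) }
finite-union (suc K) {N} P h = join (h zero) (finite-union K (P ∘ suc) (h ∘ suc))
  where
  split : ∀ i → (∃ λ j → P j i) → P zero i ⊎ (∃ λ j → P (suc j) i)
  split i (zero  , p) = inj₁ p
  split i (suc j , p) = inj₂ (j , p)
  join : (∃ λ m → ¬ AtLeast m N (P zero)) → (∃ λ m → ¬ AtLeast m N (λ i → ∃ λ j → P (suc j) i)) →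
         ∃ λ m → ¬ AtLeast m N (λ i → ∃ λ j → P j i)
  join (a , ¬a) (b , ¬b) = a ℕ.+ b , λ al →
    Sum.[ ¬a , ¬b ]′ (atLeast-⊎ a b
      (atLeast-map (λ i _ → i) (λ _ _ _ _ i<j → i<j) split (a ℕ.+ b) (λ _ _ le → le) al))

module Linear {D n t : ℕ} (M : Fin (suc n) → Map D D) (p : Fin t → List (Functional D)) where

  Word : Set
  Word = ℕ → Fin (suc n)

  shift : ℕ → Word → Word
  shift i w k = w (k ℕ.+ i)

  act : Word → ℕ → Map D D
  act w zero    = idᴹ
  act w (suc k) = M (w k) ∘ᴹ act w k

  act-+ : ∀ w k i x → app (act w (k ℕ.+ i)) x ≡ app (act (shift i w) k) (app (act w i) x)
  act-+ w zero    i x = refl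
  act-+ w (suc k) i x = cong (app (M (w (k ℕ.+ i)))) (act-+ w k i x)

  act-cong : ∀ {v w : Word} k → (∀ j → j ℕ.< k → v j ≡ w j) → ∀ x → app (act v k) x ≡ app (act w k) x
  act-cong zero            eq x = refl
  act-cong {v} {w} (suc k) eq x = trans (cong (λ α → app (M α) (app (act v k) x)) (eq k (ℕₚ.n<1+n k)))
    (cong (app (M (w k))) (act-cong k (λ j j<k → eq j (ℕₚ.m<n⇒m<1+n j<k)) x))

  act-tail : ∀ w k x → app (act w (suc k)) x ≡ app (act (w ∘ suc) k) (app (M (w 0)) x)
  act-tail w zero    x = refl
  act-tail w (suc k) x = cong (app (M (w (suc k)))) (act-tail w k x)

  Hit : Vec ℤ D → Set
  Hit x = ∃ λ i → All (λ f → ap f x ≡ 0ℤ) (p i)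

  Valid : Vec ℤ D → Set
  Valid x = ∀ w N → ∃ λ i → N ℕ.≤ i × Hit (app (act w i) x)

  prepend : Fin (suc n) → Word → Word
  prepend α w zero    = α
  prepend α w (suc k) = w k

  valid-step : ∀ {x} α → Valid x → Valid (app (M α) x)
  -- Asking for a visit from `suc N` on excludes position 0, so that it is a visit along the tail.
  valid-step {x} α val w N with val (prepend α w) (suc N)
  ... | suc i , ℕ.s≤s N≤i , hit = i , N≤i , subst Hit (act-tail (prepend α w) i x) hit

  valid-act : ∀ {x} w k → Valid x → Valid (app (act w k) x)
  valid-act w zero    val = val
  valid-act w (suc k) val = valid-step (w k) (valid-act w k val)

  -- `Outside` is the negation of `Inside` in positive form: for each disjunct it names a violated
  -- equation and a generator, from which separators are built later.
  Inside Outside : Subspace D → Map D D → Set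
  Inside  W K = ∃ λ i → ∀ x → x ∈ₛ W → All (λ f → ap f (app K x) ≡ 0ℤ) (p i)
  Outside W K = ∀ i → Any (λ f → Any (λ g → ap f (app K g) ≢ 0ℤ) (gens W)) (p i)

  inside-cong : ∀ {W K L} → (∀ x → app K x ≡ app L x) → Inside W K → Inside W L
  inside-cong eq (i , ins) = i , λ x Wx → All.map (λ {f} k → trans (cong (ap f) (sym (eq x))) k) (ins x Wx)

  outside-cong : ∀ {W K L} → (∀ x → app K x ≡ app L x) → Outside W K → Outside W L
  outside-cong eq out i = Any.map (λ {f} → Any.map (λ {g} ne k → ne (trans (cong (ap f) (eq g)) k))) (out i)

  inside⊎outside : ∀ W K → Inside W K ⊎ Outside W K
  inside⊎outside W K = Sum.swap (all-or-some t decide)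
    where
    one : ∀ f → Any (λ g → ap f (app K g) ≢ 0ℤ) (gens W) ⊎ (∀ x → x ∈ₛ W → ap f (app K x) ≡ 0ℤ)
    one f = Sum.swap (map₁ (λ k x Wx → complete W x Wx (f ∘ᶠ K) k) (vanishes? (f ∘ᶠ K) (gens W)))
    search : ∀ fs → Any (λ f → Any (λ g → ap f (app K g) ≢ 0ℤ) (gens W)) fs ⊎
                    (∀ x → x ∈ₛ W → All (λ f → ap f (app K x) ≡ 0ℤ) fs)
    search []       = inj₂ λ _ _ → []
    search (f ∷ fs) with one f
    ... | inj₁ a = inj₁ (here a)
    ... | inj₂ k = Sum.map there (λ ks x Wx → k x Wx ∷ ks x Wx) (search fs)
    decide : ∀ i → Any (λ f → Any (λ g → ap f (app K g) ≢ 0ℤ) (gens W)) (p i) ⊎ Inside W K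
    decide i = map₂ (i ,_) (search (p i))

  -- Exhaustive search of the tree of words to depth `L`, with `K` the map of the letters already
  -- read.
  escape : ∀ W L K → (∀ w → ∃ λ k → k ℕ.≤ L × Inside W (act w k ∘ᴹ K)) ⊎
                     (∃ λ w → ∀ k → k ℕ.≤ L → Outside W (act w k ∘ᴹ K))
  escape W L K with inside⊎outside W K
  escape W L       K | inj₁ ins = inj₁ λ w → 0 , ℕ.z≤n , ins
  escape W zero    K | inj₂ out = inj₂ ((λ _ → zero) , λ { zero _ → out })
  escape W (suc L) K | inj₂ out = Sum.map hit avoid
    (all-or-some (suc n) (λ α → map₂ (α ,_) (escape W L (M α ∘ᴹ K))))
    where
    hit : (∀ α w → ∃ λ k → k ℕ.≤ L × Inside W (act w k ∘ᴹ (M α ∘ᴹ K))) →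
          ∀ w → ∃ λ k → k ℕ.≤ suc L × Inside W (act w k ∘ᴹ K)
    hit h w with k , k≤L , ins ← h (w 0) (w ∘ suc) =
      suc k , ℕ.s≤s k≤L , inside-cong {W} {act (w ∘ suc) k ∘ᴹ (M (w 0) ∘ᴹ K)} {act w (suc k) ∘ᴹ K}
        (λ x → sym (act-tail w k (app K x))) ins
    avoid : (∃₂ λ α w → ∀ k → k ℕ.≤ L → Outside W (act w k ∘ᴹ (M α ∘ᴹ K))) →
            ∃ λ w → ∀ k → k ℕ.≤ suc L → Outside W (act w k ∘ᴹ K)
    avoid (α , w , outs) = prepend α w , λ
      { zero    _           → out
      ; (suc k) (ℕ.s≤s k≤L) → outside-cong {W} {act w k ∘ᴹ (M α ∘ᴹ K)} {act (prepend α w) (suc k) ∘ᴹ K}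
          (λ x → sym (act-tail (prepend α w) k (app K x))) (outs k k≤L) }

  -- The last clause says dually that the image of `W` at position `i` lies in the span of its image
  -- at `suc d + i`, without mentioning the integer multiples that a direct inclusion would need.
  Cycle : Subspace D → Set
  Cycle W = ∃ λ w → ∃₂ λ i d → (∀ k → k ℕ.≤ suc d ℕ.+ i → Outside W (act w k)) ×
    (∀ (f : Functional D) → (∀ x → x ∈ₛ W → ap f (app (act w (suc d ℕ.+ i)) x) ≡ 0ℤ) →
                             ∀ x → x ∈ₛ W → ap f (app (act w i) x) ≡ 0ℤ)

  outside-shift : ∀ {W W′} w i k → (∀ x → x ∈ₛ W → app (act w i) x ∈ₛ W′) →
                  Outside W (act w (k ℕ.+ i)) → Outside W′ (act (shift i w) k)
  outside-shift {W} {W′} w i k into out a = Any.map (λ {f} → step {f}) (out a)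
    where
    step : ∀ {f} → Any (λ g → ap f (app (act w (k ℕ.+ i)) g) ≢ 0ℤ) (gens W) →
           Any (λ g → ap f (app (act (shift i w) k) g) ≢ 0ℤ) (gens W′)
    step {f} nz with g , g∈ , ne ← find nz =
      nonzero-generator W′ (f ∘ᶠ act (shift i w) k) (app (act w i) g) (into g (All.lookup (sound W) g∈))
        (λ eq → ne (trans (cong (ap f) (act-+ w k i g)) eq))

  -- Pumping an escaping word

  module Pumping (𝒲 : List (Subspace D))
    (invariant : ∀ c α → ∃ λ c′ → ∀ x → x ∈ₛ List.lookup 𝒲 c → app (M α) x ∈ₛ List.lookup 𝒲 c′) where

    Index : Set
    Index = Fin (length 𝒲)

    W : Index → Subspace D
    W = List.lookup 𝒲

    track : ∀ w c k → ∃ λ c′ → ∀ x → x ∈ₛ W c → app (act w k) x ∈ₛ W c′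
    track w c zero    = c , λ _ Wx → Wx
    track w c (suc k) with c′ , into ← track w c k with c″ , into′ ← invariant c′ (w k) =
      c″ , λ x Wx → into′ (app (act w k) x) (into x Wx)

    keys : ℕ → ℕ
    keys l = suc n ℕ.^ l ℕ.* length 𝒲

    -- The argument `r` counts the dimension increases still to be excluded. One level leaves room
    -- for `keys l + 1` starting positions, each followed by a full window of length `l = bound r`.
    bound : ℕ → ℕ
    bound zero    = 0
    bound (suc r) = keys (bound r) ℕ.+ bound r

    window : Word → ∀ l → ℕ → Fin l → Fin (suc n)
    window w l i k = w (toℕ k ℕ.+ i)

    key : Word → Index → ∀ l → ℕ → Fin (keys l)
    key w c l i = combine (Fin.funToFin (window w l i)) (proj₁ (track w c i))

    key-word : ∀ w c l i j → key w c l i ≡ key w c l j → ∀ k → k ℕ.< l → shift i w k ≡ shift j w k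
    key-word w c l i j eq k k<l = subst (λ k → w (k ℕ.+ i) ≡ w (k ℕ.+ j)) (Finₚ.toℕ-fromℕ< k<l)
      (trans (sym (Finₚ.finToFun-funToFin (window w l i) (fromℕ< k<l))) (trans (cong (λ h → Fin.finToFun h (fromℕ< k<l))
        (Finₚ.combine-injectiveˡ (Fin.funToFin (window w l i)) (proj₁ (track w c i))
                                 (Fin.funToFin (window w l j)) (proj₁ (track w c j)) eq))
        (Finₚ.finToFun-funToFin (window w l j) (fromℕ< k<l))))

    key-index : ∀ w c l i j → key w c l i ≡ key w c l j → proj₁ (track w c i) ≡ proj₁ (track w c j)
    key-index w c l i j eq = Finₚ.combine-injectiveʳ (Fin.funToFin (window w l i)) (proj₁ (track w c i))
                                                     (Fin.funToFin (window w l j)) (proj₁ (track w c j)) eq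

    Reach : Word → ℕ → Index → Vec ℤ D → Set
    Reach w k c = image (_∈ₛ W c) (act w k)

    reach-closed : ∀ w k c → Closed (Reach w k c)
    reach-closed w k c = image-closed (act w k) (∈ₛ-closed (W c))

    0⃗∈ₛ : ∀ (V : Subspace D) → 0⃗ ∈ₛ V
    0⃗∈ₛ V = All.universal ap-0⃗ (eqns V)

    reach-0⃗ : ∀ w k c → Reach w k c 0⃗
    reach-0⃗ w k c = 0⃗ , 0⃗∈ₛ (W c) , sym (app-0⃗ (act w k))

    reach-back : ∀ w k i c {z} → Reach w (k ℕ.+ i) c z → image (Reach w i c) (act (shift i w) k) z
    reach-back w k i c (x , Wx , eq) = app (act w i) x , (x , Wx , refl) , trans eq (act-+ w k i x)

    -- Two positions i < j of a long escaping word read the same window of length l from the same component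
    -- W c′. The image of W c′ under that window contains the space reached at l + j. If it is larger, the
    -- window itself is an escaping word whose final space has greater dimension; otherwise the space reached
    -- at l + i lies in the one reached at l + j, and the word between the two can be repeated forever.
    abstract
      pump : ∀ r {ps} c w → (∀ k → k ℕ.≤ bound r → Outside (W c) (act w k)) → Independent ps →
             All (Reach w (bound r) c ∘ proj₁) ps → length ps ℕ.+ r ≡ suc D → ∃ λ c → Cycle (W c)
      pump zero c w out ind rs len = contradiction
        (ℕₚ.≤-reflexive (trans (sym len) (ℕₚ.+-identityʳ _))) (ℕₚ.≤⇒≯ (independent-length ind))
      pump (suc r) {ps} c w out ind rs len = found (repetition (keys l) (key w c l))
        where
        l : ℕ
        l = bound r
        found : (∃₂ λ i j → i ℕ.< j × j ℕ.≤ keys l × key w c l i ≡ key w c l j) → ∃ λ c → Cycle (W c)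
        -- The family sits at the end of the word; preimages move it back to `l + j`, the end of the
        -- second window.
        found (i , j , i<j , j≤ , eq) = pulled (pull-back (act (shift (l ℕ.+ j) w) m) ind
            (All.map (λ {q} h → reach-back w m (l ℕ.+ j) c (subst (λ k → Reach w k c (proj₁ q)) bound≡ h)) rs))
          where
          m : ℕ
          m = keys l ℕ.∸ j
          bound≡ : bound (suc r) ≡ m ℕ.+ (l ℕ.+ j)
          bound≡ = trans (cong (ℕ._+ l) (sym (ℕₚ.m∸n+n≡m j≤))) (alg m j l)
            where
            alg : ∀ m j l → m ℕ.+ j ℕ.+ l ≡ m ℕ.+ (l ℕ.+ j)
            alg = solveℕ-∀
          c′ : Index
          c′ = proj₁ (track w c j)
          v : Word
          v = shift j w
          into-j : ∀ x → x ∈ₛ W c → app (act w j) x ∈ₛ W c′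
          into-j = proj₂ (track w c j)
          into-i : ∀ x → x ∈ₛ W c → app (act w i) x ∈ₛ W c′
          into-i = subst (λ h → ∀ x → x ∈ₛ W c → app (act w i) x ∈ₛ W h) (key-index w c l i j eq) (proj₂ (track w c i))
          j+≤ : ∀ k → k ℕ.≤ l → k ℕ.+ j ℕ.≤ bound (suc r)
          j+≤ k k≤l = ℕₚ.≤-trans (ℕₚ.+-mono-≤ k≤l j≤) (ℕₚ.≤-reflexive (ℕₚ.+-comm l (keys l)))
          out′ : ∀ k → k ℕ.≤ l → Outside (W c′) (act v k)
          out′ k k≤l = outside-shift {W c} {W c′} w j k into-j (out (k ℕ.+ j) (j+≤ k k≤l))
          grow : ∀ {z} → Reach w (l ℕ.+ j) c z → Reach v l c′ z
          grow (x , Wx , eq) = app (act w j) x , into-j x Wx , trans eq (act-+ w l j x)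
          -- The two windows agree letter by letter, so the first one may be read as the beginning
          -- of `v`.
          through : ∀ x → app (act v l) (app (act w i) x) ≡ app (act w (l ℕ.+ i)) x
          through x = trans (sym (act-cong l (λ k k<l → key-word w c l i j eq k k<l) (app (act w i) x))) (sym (act-+ w l i x))
          pulled : (∃ λ ps′ → Independent ps′ × All (Reach w (l ℕ.+ j) c ∘ proj₁) ps′ × length ps′ ≡ length ps) →
                   ∃ λ c → Cycle (W c)
          pulled (ps′ , ind′ , rs′ , len′) = conclude (All-or-some (All.map try (sound (W c′))))
            where
            Larger : Set
            Larger = ∃ λ ps″ → Independent ps″ × All (Reach v l c′ ∘ proj₁) ps″ × length ps″ ≡ suc (length ps′)
            Dependent : Vec ℤ D → Set
            Dependent g = ∃ λ a → a ≢ 0ℤ × Reach w (l ℕ.+ j) c (a ⊡ app (act v l) g)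
            try : ∀ {g} → g ∈ₛ W c′ → Dependent g ⊎ Larger
            try {g} g∈ = extend ind′ (reach-closed w (l ℕ.+ j) c) (reach-0⃗ w (l ℕ.+ j) c) rs′
              (reach-closed v l c′) grow (app (act v l) g) (g , g∈ , refl)
            conclude : All Dependent (gens (W c′)) ⊎ Larger → ∃ λ c → Cycle (W c)
            -- The window at `j`, now started from the whole of `W c′`, reaches one more dimension;
            -- continue with it and the smaller `r`.
            conclude (inj₂ (ps″ , ind″ , rs″ , len″)) =
              pump r c′ v out′ ind″ rs″ (trans (cong (ℕ._+ r) (trans len″ (cong suc len′))) (trans (sym (ℕₚ.+-suc (length ps) r)) len))
            -- The cycle begins at `l + i`, the end of the first window, and its length is
            -- `suc d = j - i`.
            conclude (inj₁ dep) with d , i+d≡j ← ℕₚ.m≤n⇒∃[o]m+o≡n i<j = c , w , l ℕ.+ i , d ,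
              (λ k k≤ → out k (ℕₚ.≤-trans (subst (k ℕ.≤_) (pos≡ i+d≡j) k≤) (j+≤ l ℕₚ.≤-refl))) ,
              λ f kill x Wx → trans (cong (ap f) (sym (through x)))
                (complete (W c′) (app (act w i) x) (into-i x Wx) (f ∘ᶠ act v l)
                  (All.map (λ {g} → dead f (λ x Wx → trans (cong (λ k → ap f (app (act w k) x)) (sym (pos≡ i+d≡j))) (kill x Wx)) {g}) dep))
              where
              pos≡ : ∀ {d} → suc i ℕ.+ d ≡ j → suc d ℕ.+ (l ℕ.+ i) ≡ l ℕ.+ j
              pos≡ {d} refl = alg d l i
                where
                alg : ∀ d l i → suc d ℕ.+ (l ℕ.+ i) ≡ l ℕ.+ (suc i ℕ.+ d)
                alg = solveℕ-∀
              dead : ∀ f → (∀ x → x ∈ₛ W c → ap f (app (act w (l ℕ.+ j)) x) ≡ 0ℤ) →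
                     ∀ {g} → Dependent g → ap f (app (act v l) g) ≡ 0ℤ
              dead f kill {g} (a , a≢0 , x , Wx , eq) =
                cancel-≢0 a≢0 (trans (sym (ap-⊡ f a (app (act v l) g))) (trans (cong (ap f) eq) (kill x Wx)))

  Refinable : Subspace D → Set
  Refinable W = ∃ λ ls → All (λ ℓ → Any (λ g → ap ℓ g ≢ 0ℤ) (gens W)) ls ×
    (∀ y → y ∈ₛ W → Valid y → Any (λ ℓ → ap ℓ y ≡ 0ℤ) ls)

  -- Separating functionals from an ultimately periodic word

  module Periodic (W : Subspace D) (w : Word) (i₀ d : ℕ)
    (out : ∀ k → k ℕ.≤ suc d ℕ.+ i₀ → Outside W (act w k))
    (back : ∀ (f : Functional D) → (∀ x → x ∈ₛ W → ap f (app (act w (suc d ℕ.+ i₀)) x) ≡ 0ℤ) →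
                                    ∀ x → x ∈ₛ W → ap f (app (act w i₀) x) ≡ 0ℤ) where

    per : ℕ
    per = suc d

    v : Word
    v k = w (k ℕ.% per ℕ.+ i₀)

    T : Map D D
    T = act v per

    start : Map D D
    start = act w i₀

    act-v-initial : ∀ k → k ℕ.≤ per → ∀ x → app (act v k) (app start x) ≡ app (act w (k ℕ.+ i₀)) x
    act-v-initial k k≤per x = trans
      (act-cong k (λ j j<k → cong (λ h → w (h ℕ.+ i₀)) (ℕ%.m<n⇒m%n≡m (ℕₚ.<-≤-trans j<k k≤per))) (app start x))
      (sym (act-+ w k i₀ x))

    act-v-period : ∀ k x → app (act v (k ℕ.+ per)) x ≡ app (act v k) (app T x)
    act-v-period k x = trans (act-+ v k per x)
      (act-cong k (λ j _ → cong (λ h → w (h ℕ.+ i₀)) (ℕ%.[m+n]%n≡m%n j per)) (app T x))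

    act-v-iter : ∀ k q x → app (act v (k ℕ.+ q ℕ.* per)) x ≡ app (act v k) (app (iter T q) x)
    act-v-iter k zero    x = cong (λ h → app (act v h) x) (ℕₚ.+-identityʳ k)
    act-v-iter k (suc q) x = begin
      app (act v (k ℕ.+ (per ℕ.+ q ℕ.* per))) x   ≡⟨ cong (λ h → app (act v h) x) (alg k per (q ℕ.* per)) ⟩
      app (act v (k ℕ.+ q ℕ.* per ℕ.+ per)) x     ≡⟨ act-v-period (k ℕ.+ q ℕ.* per) x ⟩
      app (act v (k ℕ.+ q ℕ.* per)) (app T x)     ≡⟨ act-v-iter k q (app T x) ⟩
      app (act v k) (app (iter T q) (app T x))    ∎
      where
      open ≡-Reasoning
      alg : ∀ k a b → k ℕ.+ (a ℕ.+ b) ≡ k ℕ.+ b ℕ.+ a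
      alg = solveℕ-∀

    -- Suppose `f` vanished one period later. Then `back`, applied to `f` after `act v r` and `T^q`,
    -- makes it vanish at the present period too, against the induction hypothesis.
    out-iter : ∀ q r → r ℕ.< per → Outside W (act v r ∘ᴹ (iter T q ∘ᴹ start))
    out-iter zero    r r<per = outside-cong {W} {act w (r ℕ.+ i₀)} {act v r ∘ᴹ (iter T 0 ∘ᴹ start)}
      (λ x → sym (act-v-initial r (ℕₚ.<⇒≤ r<per) x)) (out (r ℕ.+ i₀) (ℕₚ.+-monoˡ-≤ i₀ (ℕₚ.<⇒≤ r<per)))
    out-iter (suc q) r r<per i = Any.map (λ {f} → step f) (out-iter q r r<per i)
      where
      step : ∀ f → Any (λ g → ap f (app (act v r) (app (iter T q) (app start g))) ≢ 0ℤ) (gens W) →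
                   Any (λ g → ap f (app (act v r) (app (iter T q) (app T (app start g)))) ≢ 0ℤ) (gens W)
      step f nz with vanishes? (f ∘ᶠ (act v r ∘ᴹ (iter T q ∘ᴹ (T ∘ᴹ start)))) (gens W)
      ... | inj₂ a = a
      ... | inj₁ k with g , g∈ , ne ← find nz = contradiction
        (back (f ∘ᶠ (act v r ∘ᴹ iter T q)) (λ x Wx → trans
          (cong (λ h → ap f (app (act v r) (app (iter T q) h))) (sym (act-v-initial per ℕₚ.≤-refl x)))
          (complete W x Wx (f ∘ᶠ (act v r ∘ᴹ (iter T q ∘ᴹ (T ∘ᴹ start)))) k)) g (All.lookup (sound W) g∈)) ne

    out-everywhere : ∀ k q → Outside W (act v k ∘ᴹ (iter T q ∘ᴹ start))
    out-everywhere k q = outside-cong {W} {act v (k ℕ.% per) ∘ᴹ (iter T (q ℕ.+ k ℕ./ per) ∘ᴹ start)} {act v k ∘ᴹ (iter T q ∘ᴹ start)}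
      (λ x → begin
        app (act v (k ℕ.% per)) (app (iter T (q ℕ.+ k ℕ./ per)) (app start x))
          ≡⟨ cong (app (act v (k ℕ.% per))) (iter-+ T q (k ℕ./ per) (app start x)) ⟩
        app (act v (k ℕ.% per)) (app (iter T (k ℕ./ per)) (app (iter T q) (app start x)))
          ≡⟨ sym (act-v-iter (k ℕ.% per) (k ℕ./ per) (app (iter T q) (app start x))) ⟩
        app (act v (k ℕ.% per ℕ.+ k ℕ./ per ℕ.* per)) (app (iter T q) (app start x))
          ≡⟨ cong (λ h → app (act v h) (app (iter T q) (app start x))) (sym (ℕ%.m≡m%n+[m/n]*n k per)) ⟩
        app (act v k) (app (iter T q) (app start x)) ∎)
      (out-iter (q ℕ.+ k ℕ./ per) (k ℕ.% per) (ℕ%.m%n<n k per))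
      where open ≡-Reasoning

    module _ (J R : ℕ) (few : FewZeros T J (suc R)) where

      -- Zeros are controlled along powers of `T^(R+1)`, so positions are sorted into residue
      -- classes modulo this many letters.
      Λ : ℕ
      Λ = suc R ℕ.* per

      witness : ∀ c i → ∃ λ f → f ∈ p i × Any (λ g → ap f (app (act v c) (app (iter T J) (app start g))) ≢ 0ℤ) (gens W)
      witness c i = find (out-everywhere c J i)

      -- Its value at `y` is the initial term of the sequence attached to class `c` and disjunct
      -- `i`; when that is nonzero, `few` bounds the zeros of the sequence.
      separator : ℕ → Fin t → Functional D
      separator c i = proj₁ (witness c i) ∘ᶠ (act v c ∘ᴹ (iter T J ∘ᴹ start))

      separators : List (Functional D)
      separators = List.tabulate {n = Λ ℕ.* t} (λ j → separator (toℕ (proj₁ (remQuot {Λ} t j))) (proj₂ (remQuot {Λ} t j)))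

      separators-nonzero : All (λ ℓ → Any (λ g → ap ℓ g ≢ 0ℤ) (gens W)) separators
      separators-nonzero = Allₚ.tabulate⁺ {n = Λ ℕ.* t} λ j →
        proj₂ (proj₂ (witness (toℕ (proj₁ (remQuot {Λ} t j))) (proj₂ (remQuot {Λ} t j))))

      Visit : Vec ℤ D → Fin Λ → Fin t → ℕ → Set
      Visit z c i pos = ∃ λ k → pos ≡ toℕ c ℕ.+ (J ℕ.+ k ℕ.* suc R) ℕ.* per ×
        ap (proj₁ (witness (toℕ c) i) ∘ᶠ act v (toℕ c)) (app (iter (iter T (suc R)) k) (app (iter T J) z)) ≡ 0ℤ

      iter-iter : ∀ (A : Map D D) r k x → app (iter (iter A r) k) x ≡ app (iter A (k ℕ.* r)) x
      iter-iter A r zero    x = refl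
      iter-iter A r (suc k) x = trans (iter-iter A r k (app (iter A r) x)) (sym (iter-+ A r (k ℕ.* r) x))

      -- A position past the first `J` periods is divided with remainder by `Λ`. Meeting disjunct
      -- `i` makes all its equations vanish, in particular the chosen witness.
      hit⇒visit : ∀ z pos → J ℕ.* per ℕ.≤ pos → Hit (app (act v pos) z) → ∃ λ c → ∃ λ i → Visit z c i pos
      hit⇒visit z pos le (i , ks) = c , i , k , pos≡ , trans (cong (ap f) state≡) (All.lookup ks f∈)
        where
        open ≡-Reasoning
        m k : ℕ
        m = pos ℕ.∸ J ℕ.* per
        k = m ℕ./ Λ
        c : Fin Λ
        c = fromℕ< (ℕ%.m%n<n m Λ)
        f : Functional D
        f = proj₁ (witness (toℕ c) i)
        f∈ : f ∈ p i
        f∈ = proj₁ (proj₂ (witness (toℕ c) i))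
        alg : ∀ c k r d J → c ℕ.+ k ℕ.* (r ℕ.* d) ℕ.+ J ℕ.* d ≡ c ℕ.+ (J ℕ.+ k ℕ.* r) ℕ.* d
        alg = solveℕ-∀
        pos≡ : pos ≡ toℕ c ℕ.+ (J ℕ.+ k ℕ.* suc R) ℕ.* per
        pos≡ = begin
          pos                                          ≡⟨ sym (ℕₚ.m∸n+n≡m le) ⟩
          m ℕ.+ J ℕ.* per                              ≡⟨ cong (ℕ._+ J ℕ.* per) (ℕ%.m≡m%n+[m/n]*n m Λ) ⟩
          m ℕ.% Λ ℕ.+ k ℕ.* Λ ℕ.+ J ℕ.* per            ≡⟨ cong (λ h → h ℕ.+ k ℕ.* Λ ℕ.+ J ℕ.* per) (sym (Finₚ.toℕ-fromℕ< (ℕ%.m%n<n m Λ))) ⟩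
          toℕ c ℕ.+ k ℕ.* Λ ℕ.+ J ℕ.* per              ≡⟨ alg (toℕ c) k (suc R) per J ⟩
          toℕ c ℕ.+ (J ℕ.+ k ℕ.* suc R) ℕ.* per        ∎
        state≡ : app (act v (toℕ c)) (app (iter (iter T (suc R)) k) (app (iter T J) z)) ≡ app (act v pos) z
        state≡ = begin
          app (act v (toℕ c)) (app (iter (iter T (suc R)) k) (app (iter T J) z))
            ≡⟨ cong (app (act v (toℕ c))) (iter-iter T (suc R) k (app (iter T J) z)) ⟩
          app (act v (toℕ c)) (app (iter T (k ℕ.* suc R)) (app (iter T J) z))
            ≡⟨ cong (app (act v (toℕ c))) (sym (iter-+ T J (k ℕ.* suc R) z)) ⟩
          app (act v (toℕ c)) (app (iter T (J ℕ.+ k ℕ.* suc R)) z)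
            ≡⟨ sym (act-v-iter (toℕ c) (J ℕ.+ k ℕ.* suc R) z) ⟩
          app (act v (toℕ c ℕ.+ (J ℕ.+ k ℕ.* suc R) ℕ.* per)) z
            ≡⟨ cong (λ h → app (act v h) z) (sym pos≡) ⟩
          app (act v pos) z ∎

      visit-increasing : ∀ z c i a b (va : Visit z c i a) (vb : Visit z c i b) → a ℕ.< b → proj₁ va ℕ.< proj₁ vb
      visit-increasing z c i a b (k , a≡ , _) (l , b≡ , _) a<b = ℕₚ.≰⇒> λ l≤k → ℕₚ.<⇒≱ a<b
        (subst₂ ℕ._≤_ (sym b≡) (sym a≡) (ℕₚ.+-monoʳ-≤ (toℕ c) (ℕₚ.*-monoˡ-≤ per (ℕₚ.+-monoʳ-≤ J (ℕₚ.*-monoˡ-≤ (suc R) l≤k)))))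

      -- If no separator vanishes at `y`, each of the finitely many sequences has boundedly many
      -- zeros. The bounds combine to one for all visits, which infinitely many visits would exceed.
      visits-bounded : ∀ y → (∀ (c : Fin Λ) i → ap (separator (toℕ c) i) y ≢ 0ℤ) → ¬ Valid y
      visits-bounded y ne val = proj₂ total (atLeast-map (λ pos _ → pos) (λ _ _ _ _ lt → lt)
          (λ pos (le , hit) → hit⇒visit z pos le hit) (proj₁ total) (λ _ _ le → le)
          (infinite⇒atLeast {λ pos → J ℕ.* per ℕ.≤ pos × Hit (app (act v pos) z)} often (proj₁ total) 0))
        where
        z : Vec ℤ D
        z = app start y
        often : ∀ N → ∃ λ pos → N ℕ.≤ pos × J ℕ.* per ℕ.≤ pos × Hit (app (act v pos) z)
        often N with pos , le , hit ← valid-act w i₀ val v (N ℕ.⊔ J ℕ.* per) =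
          pos , ℕₚ.≤-trans (ℕₚ.m≤m⊔n N (J ℕ.* per)) le , ℕₚ.≤-trans (ℕₚ.m≤n⊔m N (J ℕ.* per)) le , hit
        one : ∀ c i → ∃ λ m → ¬ AtLeast m 0 (Visit z c i)
        one c i with m , ¬al ← few (proj₁ (witness (toℕ c) i) ∘ᶠ act v (toℕ c)) z (ne c i) =
          m , λ al → ¬al (atLeast-map (λ _ → proj₁) (visit-increasing z c i) (λ _ → proj₂ ∘ proj₂) m (λ _ _ _ → ℕ.z≤n) al)
        total : ∃ λ m → ¬ AtLeast m 0 (λ pos → ∃ λ c → ∃ λ i → Visit z c i pos)
        total = finite-union Λ (λ c pos → ∃ λ i → Visit z c i pos) (λ c → finite-union t (Visit z c) (one c))

      separators-cover : ∀ y → Valid y → Any (λ ℓ → ap ℓ y ≡ 0ℤ) separators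
      separators-cover y val with Any.any? (λ ℓ → ap ℓ y ℤ.≟ 0ℤ) separators
      ... | yes a = a
      ... | no ¬a = contradiction val (visits-bounded y λ c i eq → ¬a (Anyₚ.tabulate⁺ (combine c i)
          (subst (λ ci → ap (separator (toℕ (proj₁ ci)) (proj₂ ci)) y ≡ 0ℤ) (sym (Finₚ.remQuot-combine c i)) eq)))

  cycle⇒refinable : ∀ W → Cycle W → Refinable W
  cycle⇒refinable W (w , i , d , out , back) = conclude (skolem (Periodic.T W w i d out back))
    where
    open Periodic W w i d out back
    conclude : (∃₂ λ J R → FewZeros T J (suc R)) → Refinable W
    conclude (J , R , few) = separators J R few , separators-nonzero J R few , λ y _ val → separators-cover J R few y val

  -- Cutting a cover or proving it sound

  Covers : List (Subspace D) → Set
  Covers 𝒲 = ∀ y → Valid y → Any (y ∈ₛ_) 𝒲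

  module _ (𝒲 : List (Subspace D)) (covers : Covers 𝒲) where

    module _ (c : Fin (length 𝒲)) (α : Fin (suc n)) where

      NotInto : Fin (length 𝒲) → Set
      NotInto c′ = ∃ λ h → h ∈ eqns (List.lookup 𝒲 c′) × Any (λ g → ap h (app (M α) g) ≢ 0ℤ) (gens (List.lookup 𝒲 c))

      Into : Set
      Into = ∃ λ c′ → ∀ x → x ∈ₛ List.lookup 𝒲 c → app (M α) x ∈ₛ List.lookup 𝒲 c′

      into? : ∀ c′ → NotInto c′ ⊎ Into
      into? c′ with Any.any? (λ h → Any.any? (λ g → ¬? (ap h (app (M α) g) ℤ.≟ 0ℤ)) (gens (List.lookup 𝒲 c))) (eqns (List.lookup 𝒲 c′))
      ... | yes a  = inj₁ (find a)
      ... | no  ¬a = inj₂ (c′ , λ x Wx → All.map (λ {h} ¬h → dead x Wx h ¬h) (Allₚ.¬Any⇒All¬ _ ¬a))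
        where
        dead : ∀ x → x ∈ₛ List.lookup 𝒲 c → ∀ h → ¬ Any (λ g → ap h (app (M α) g) ≢ 0ℤ) (gens (List.lookup 𝒲 c)) → ap h (app (M α) x) ≡ 0ℤ
        dead x Wx h ¬h with vanishes? (h ∘ᶠ M α) (gens (List.lookup 𝒲 c))
        ... | inj₁ k = complete (List.lookup 𝒲 c) x Wx (h ∘ᶠ M α) k
        ... | inj₂ a = contradiction a ¬h

      -- Choose for every member an equation that fails on the image. A valid vector has a valid
      -- successor, which the cover places in some member, so the equation chosen for that member,
      -- pulled back along `M α`, kills the vector.
      into⊎refinable : Into ⊎ Refinable (List.lookup 𝒲 c)
      into⊎refinable with all-or-some (length 𝒲) into?
      ... | inj₂ into = inj₁ into
      ... | inj₁ nots = inj₂ (List.tabulate (λ c′ → proj₁ (nots c′) ∘ᶠ M α) ,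
              Allₚ.tabulate⁺ (λ c′ → proj₂ (proj₂ (nots c′))) , λ y Wy val →
              let a = covers (app (M α) y) (valid-step α val) in
              Anyₚ.tabulate⁺ (Any.index a) (All.lookup (Anyₚ.lookup-index a) (proj₁ (proj₂ (nots (Any.index a))))))

    Sound : Set
    Sound = ∀ y → Any (y ∈ₛ_) 𝒲 → Valid y

    module _ (invariant : ∀ c α → Into c α) where

      open Pumping 𝒲 invariant

      window-length : ℕ
      window-length = bound (suc D)

      HitsSoon : Fin (length 𝒲) → Set
      HitsSoon c = ∀ w → ∃ λ k → k ℕ.≤ window-length × Inside (List.lookup 𝒲 c) (act w k)

      hits⊎refinable : ∀ c → HitsSoon c ⊎ (∃ λ c → Refinable (List.lookup 𝒲 c))
      hits⊎refinable c = map₂ pumped (escape (List.lookup 𝒲 c) window-length idᴹ)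
        where
        pumped : (∃ λ w → ∀ k → k ℕ.≤ window-length → Outside (List.lookup 𝒲 c) (act w k)) → ∃ λ c → Refinable (List.lookup 𝒲 c)
        -- Pumping starts from the empty family, with all `suc D` increases still open.
        pumped (w , out) with c′ , cyc ← pump (suc D) {[]} c w out [] [] refl = c′ , cycle⇒refinable (List.lookup 𝒲 c′) cyc

      -- After any `N` letters the orbit is still in some member, and from there it meets the union
      -- within the window.
      hits⇒sound : (∀ c → HitsSoon c) → Sound
      hits⇒sound hits y a w N with c′ , into ← track w (Any.index a) N with k , _ , i , ins ← hits c′ (shift N w) =
        k ℕ.+ N , ℕₚ.m≤n+m N k , subst Hit (sym (act-+ w k N y)) (i , ins (app (act w N) y) (into y (Anyₚ.lookup-index a)))

    abstract
      refinable⊎sound : (∃ λ c → Refinable (List.lookup 𝒲 c)) ⊎ Sound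
      refinable⊎sound with all-or-some (length 𝒲) (λ c → map₂ (c ,_) (all-or-some (suc n) (into⊎refinable c)))
      ... | inj₂ ref       = inj₁ ref
      ... | inj₁ invariant = Sum.swap (map₁ (hits⇒sound invariant) (all-or-some (length 𝒲) (hits⊎refinable invariant)))

  -- Termination of the cutting

  replace : (𝒲 : List (Subspace D)) → Fin (length 𝒲) → List (Subspace D) → List (Subspace D)
  replace (W ∷ 𝒲) zero    Ws = Ws ++ 𝒲
  replace (W ∷ 𝒲) (suc c) Ws = W ∷ replace 𝒲 c Ws

  replace-covers : ∀ {y} 𝒲 c {Ws} → (y ∈ₛ List.lookup 𝒲 c → Any (y ∈ₛ_) Ws) → Any (y ∈ₛ_) 𝒲 → Any (y ∈ₛ_) (replace 𝒲 c Ws)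
  replace-covers (W ∷ 𝒲) zero         h (here Wy) = Anyₚ.++⁺ˡ (h Wy)
  replace-covers (W ∷ 𝒲) zero    {Ws} h (there a) = Anyₚ.++⁺ʳ Ws a
  replace-covers (W ∷ 𝒲) (suc c)      h (here Wy) = here Wy
  replace-covers (W ∷ 𝒲) (suc c)      h (there a) = there (replace-covers 𝒲 c h a)

  -- One step of the multiset order on sizes, presented on lists.
  data _≺_ : List (Subspace D) → List (Subspace D) → Set where
    here  : ∀ {W 𝒲 Ws} → All (λ V → size V ℕ.< size W) Ws → (Ws ++ 𝒲) ≺ (W ∷ 𝒲)
    there : ∀ {W 𝒲 𝒲′} → 𝒲′ ≺ 𝒲 → (W ∷ 𝒲′) ≺ (W ∷ 𝒲)

  replace-≺ : ∀ 𝒲 c {Ws} → All (λ V → size V ℕ.< size (List.lookup 𝒲 c)) Ws → replace 𝒲 c Ws ≺ 𝒲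
  replace-≺ (W ∷ 𝒲) zero    lt = here lt
  replace-≺ (W ∷ 𝒲) (suc c) lt = there (replace-≺ 𝒲 c lt)

  AddAcc : Subspace D → Set
  AddAcc W = ∀ {𝒲} → Acc _≺_ 𝒲 → Acc _≺_ (W ∷ 𝒲)

  ++-acc : ∀ {Ws 𝒲} → All AddAcc Ws → Acc _≺_ 𝒲 → Acc _≺_ (Ws ++ 𝒲)
  ++-acc []       a = a
  ++-acc (f ∷ fs) a = f (++-acc fs a)

  -- Nested induction: replacing the head by smaller members is covered by the hypothesis on sizes,
  -- and a step in the tail by the accessibility of the tail.
  add-acc : ∀ W → (∀ {V} → size V ℕ.< size W → AddAcc V) → AddAcc W
  add-acc W ih a@(acc rs) = acc λ
    { (here lt) → ++-acc (All.map ih lt) a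
    ; (there p) → add-acc W ih (rs p) }

  add-acc-all : ∀ s W → size W ≡ s → AddAcc W
  add-acc-all = <-rec (λ s → ∀ W → size W ≡ s → AddAcc W)
    λ s rec W eq → add-acc W (λ {V} lt → rec (subst (size V ℕ.<_) eq lt) V refl)

  ≺-wellFounded : ∀ 𝒲 → Acc _≺_ 𝒲
  ≺-wellFounded []      = acc λ ()
  ≺-wellFounded (W ∷ 𝒲) = add-acc-all (size W) W refl (≺-wellFounded 𝒲)

  refine-all : ∀ (W : Subspace D) ls → All (λ ℓ → Any (λ g → ap ℓ g ≢ 0ℤ) (gens W)) ls →
               ∃ λ Ws → All (λ V → size V ℕ.< size W) Ws × (∀ y → y ∈ₛ W → Any (λ ℓ → ap ℓ y ≡ 0ℤ) ls → Any (y ∈ₛ_) Ws)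
  refine-all W []       []         = [] , [] , λ _ _ ()
  refine-all W (ℓ ∷ ls) (nz ∷ nzs) with V , eq , eqs ← refine W ℓ nz | Ws , lt , cov ← refine-all W ls nzs =
    V ∷ Ws , ℕₚ.≤-reflexive eq ∷ lt , λ
      { y Wy (here ℓy) → here (subst (All (λ h → ap h y ≡ 0ℤ)) (sym eqs) (ℓy ∷ Wy))
      ; y Wy (there a) → there (cov y Wy a) }

  solve : ∀ 𝒲 → Acc _≺_ 𝒲 → Covers 𝒲 → ∃ λ 𝒲 → Covers 𝒲 × (∀ y → Any (y ∈ₛ_) 𝒲 → Valid y)
  solve 𝒲 (acc rs) cov = next (refinable⊎sound 𝒲 cov)
    where
    next : (∃ λ c → Refinable (List.lookup 𝒲 c)) ⊎ Sound 𝒲 cov → ∃ λ 𝒲 → Covers 𝒲 × (∀ y → Any (y ∈ₛ_) 𝒲 → Valid y)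
    next (inj₂ snd) = 𝒲 , cov , snd
    next (inj₁ (c , ls , nz , hit)) with Ws , lt , cov′ ← refine-all (List.lookup 𝒲 c) ls nz =
      solve (replace 𝒲 c Ws) (rs (replace-≺ 𝒲 c lt))
        (λ y val → replace-covers 𝒲 c (λ Wy → cov′ y Wy (hit y Wy val)) (cov y val))

  valid? : ∀ x → Dec (Valid x)
  valid? x with 𝒲 , cov , snd ← solve (whole ∷ []) (≺-wellFounded _) (λ _ _ → here []) with Any.any? (x ∈ₛ?_) 𝒲
  ... | yes a = yes (snd x a)
  ... | no ¬a = no (¬a ∘ cov x)

-- Gaussian rational matrices as integer vectors

ι : ℤ → ℚ
ι a = mkℚ a 0 (Coprimality.sym (Coprimality.1-coprimeTo _))

ι-injective : ∀ {a b} → ι a ≡ ι b → a ≡ b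
ι-injective = cong ↥_

ι-+ : ∀ a b → ι (a ℤ.+ b) ≡ ι a Q.+ ι b
ι-+ a b = Qₚ.toℚᵘ-injective (Qᵘₚ.≃-trans (*≡* (alg a b)) (Qᵘₚ.≃-sym (Qₚ.toℚᵘ-homo-+ (ι a) (ι b))))
  where
  alg : ∀ a b → (a ℤ.+ b) ℤ.* (1ℤ ℤ.* 1ℤ) ≡ (a ℤ.* 1ℤ ℤ.+ b ℤ.* 1ℤ) ℤ.* 1ℤ
  alg = solve-∀

ι-* : ∀ a b → ι (a ℤ.* b) ≡ ι a Q.* ι b
ι-* a b = Qₚ.toℚᵘ-injective (Qᵘₚ.≃-trans (*≡* refl) (Qᵘₚ.≃-sym (Qₚ.toℚᵘ-homo-* (ι a) (ι b))))

ι-denominator : ∀ q → ι (↥ q) ≡ ι (↧ q) Q.* q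
ι-denominator q@record{} = Qₚ.toℚᵘ-injective (Qᵘₚ.≃-trans (*≡* (alg (↥ q) (↧ q))) (Qᵘₚ.≃-sym (Qₚ.toℚᵘ-homo-* (ι (↧ q)) q)))
  where
  alg : ∀ n d → n ℤ.* (1ℤ ℤ.* d) ≡ (d ℤ.* n) ℤ.* 1ℤ
  alg = solve-∀

ι-cancel : ∀ {m r} → m ≢ 0ℤ → ι m Q.* r ≡ 0ℚ → r ≡ 0ℚ
ι-cancel {m} {r} m≢0 eq = Qₚ.↥p≡0⇒p≡0 r (cancel-≢0 m≢0 (ι-injective (begin
  ι (m ℤ.* ↥ r)                ≡⟨ ι-* m (↥ r) ⟩
  ι m Q.* ι (↥ r)              ≡⟨ cong (ι m Q.*_) (trans (ι-denominator r) (Qₚ.*-comm (ι (↧ r)) r)) ⟩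
  ι m Q.* (r Q.* ι (↧ r))      ≡⟨ sym (Qₚ.*-assoc (ι m) r (ι (↧ r))) ⟩
  ι m Q.* r Q.* ι (↧ r)        ≡⟨ cong (Q._* ι (↧ r)) eq ⟩
  0ℚ Q.* ι (↧ r)               ≡⟨ Qₚ.*-zeroˡ (ι (↧ r)) ⟩
  ι 0ℤ                         ∎)))
  where open ≡-Reasoning

common-denominator : ∀ m (r : Fin m → ℚ) → ∃ λ q → q ≢ 0ℤ × ∀ i → ∃ λ a → ι a ≡ ι q Q.* r i
common-denominator zero    r = 1ℤ , (λ ()) , λ ()
common-denominator (suc m) r with q , q≢0 , h ← common-denominator m (r ∘ suc) =
  ↧ (r zero) ℤ.* q , ≢0-* {↧ (r zero)} {q} (λ ()) q≢0 , λ
    { zero    → q ℤ.* ↥ (r zero) , (begin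
        ι (q ℤ.* ↥ (r zero))                   ≡⟨ ι-* q (↥ (r zero)) ⟩
        ι q Q.* ι (↥ (r zero))                 ≡⟨ cong (ι q Q.*_) (ι-denominator (r zero)) ⟩
        ι q Q.* (ι (↧ (r zero)) Q.* r zero)    ≡⟨ sym (Qₚ.*-assoc (ι q) (ι (↧ (r zero))) (r zero)) ⟩
        ι q Q.* ι (↧ (r zero)) Q.* r zero      ≡⟨ cong (Q._* r zero) (trans (Qₚ.*-comm (ι q) (ι (↧ (r zero)))) (sym (ι-* (↧ (r zero)) q))) ⟩
        ι (↧ (r zero) ℤ.* q) Q.* r zero        ∎)
    ; (suc i) → ↧ (r zero) ℤ.* proj₁ (h i) , (begin
        ι (↧ (r zero) ℤ.* proj₁ (h i))                 ≡⟨ ι-* (↧ (r zero)) (proj₁ (h i)) ⟩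
        ι (↧ (r zero)) Q.* ι (proj₁ (h i))             ≡⟨ cong (ι (↧ (r zero)) Q.*_) (proj₂ (h i)) ⟩
        ι (↧ (r zero)) Q.* (ι q Q.* r (suc i))         ≡⟨ sym (Qₚ.*-assoc (ι (↧ (r zero))) (ι q) (r (suc i))) ⟩
        ι (↧ (r zero)) Q.* ι q Q.* r (suc i)           ≡⟨ cong (Q._* r (suc i)) (sym (ι-* (↧ (r zero)) q)) ⟩
        ι (↧ (r zero) ℤ.* q) Q.* r (suc i)             ∎) }
  where open ≡-Reasoning

module Clearing {D E : ℕ} (F : Fin E → Vec ℤ D → ℚ)
  (F-⊞ : ∀ i x y → F i (x ⊞ y) ≡ F i x Q.+ F i y) (F-⊡ : ∀ i c x → F i (c ⊡ x) ≡ ι c Q.* F i x) where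

  denominators : ∃ λ q → q ≢ 0ℤ × ∀ k → ∃ λ a → ι a ≡ ι q Q.* F (proj₁ (remQuot {E} D k)) (e (proj₂ (remQuot {E} D k)))
  denominators = common-denominator (E ℕ.* D) (λ k → F (proj₁ (remQuot {E} D k)) (e (proj₂ (remQuot {E} D k))))

  q : ℤ
  q = proj₁ denominators

  Integral : Fin E → Vec ℤ D → Set
  Integral i x = ∃ λ a → ι a ≡ ι q Q.* F i x

  integral-closed : ∀ i → Closed (Integral i)
  integral-closed i a x b y (m , m≡) (l , l≡) = a ℤ.* m ℤ.+ b ℤ.* l , (begin
    ι (a ℤ.* m ℤ.+ b ℤ.* l)                               ≡⟨ ι-+ (a ℤ.* m) (b ℤ.* l) ⟩
    ι (a ℤ.* m) Q.+ ι (b ℤ.* l)                           ≡⟨ cong₂ Q._+_ (ι-* a m) (ι-* b l) ⟩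
    ι a Q.* ι m Q.+ ι b Q.* ι l                           ≡⟨ cong₂ (λ s t → ι a Q.* s Q.+ ι b Q.* t) m≡ l≡ ⟩
    ι a Q.* (ι q Q.* F i x) Q.+ ι b Q.* (ι q Q.* F i y)   ≡⟨ alg (ι a) (ι b) (ι q) (F i x) (F i y) ⟩
    ι q Q.* (ι a Q.* F i x Q.+ ι b Q.* F i y)             ≡⟨ cong (ι q Q.*_) (sym (trans (F-⊞ i (a ⊡ x) (b ⊡ y)) (cong₂ Q._+_ (F-⊡ i a x) (F-⊡ i b y)))) ⟩
    ι q Q.* F i (a ⊡ x ⊞ b ⊡ y)                           ∎)
    where
    open ≡-Reasoning
    alg : ∀ a b q x y → a Q.* (q Q.* x) Q.+ b Q.* (q Q.* y) ≡ q Q.* (a Q.* x Q.+ b Q.* y)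
    alg = solve 5 (λ a b q x y → a :* (q :* x) :+ b :* (q :* y) := q :* (a :* x :+ b :* y)) refl
      where open +-*-Solver

  integral-0⃗ : ∀ i → Integral i 0⃗
  integral-0⃗ i = 0ℤ , sym (trans (cong (ι q Q.*_) (trans (cong (F i) (sym (⊡-zero 0⃗))) (trans (F-⊡ i 0ℤ 0⃗) (Qₚ.*-zeroˡ (F i 0⃗))))) (Qₚ.*-zeroʳ (ι q)))

  integral : ∀ i x → Integral i x
  integral i = basis-induction (Integral i) (integral-closed i) (integral-0⃗ i) λ j →
    subst (λ k → Integral (proj₁ k) (e (proj₂ k))) (Finₚ.remQuot-combine i j) (proj₂ (proj₂ denominators) (combine i j))

  -- The integer is extracted from the proof of integrality; its linearity is inherited from `F`
  -- because `ι` is injective.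
  row : Fin E → Vec ℤ D → ℤ
  row i x = proj₁ (integral i x)

  row-≡ : ∀ i x → ι (row i x) ≡ ι q Q.* F i x
  row-≡ i x = proj₂ (integral i x)

  row-⊞ : ∀ i x y → row i (x ⊞ y) ≡ row i x ℤ.+ row i y
  row-⊞ i x y = ι-injective (begin
    ι (row i (x ⊞ y))                     ≡⟨ row-≡ i (x ⊞ y) ⟩
    ι q Q.* F i (x ⊞ y)                   ≡⟨ cong (ι q Q.*_) (F-⊞ i x y) ⟩
    ι q Q.* (F i x Q.+ F i y)             ≡⟨ Qₚ.*-distribˡ-+ (ι q) (F i x) (F i y) ⟩
    ι q Q.* F i x Q.+ ι q Q.* F i y       ≡⟨ cong₂ Q._+_ (sym (row-≡ i x)) (sym (row-≡ i y)) ⟩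
    ι (row i x) Q.+ ι (row i y)           ≡⟨ sym (ι-+ (row i x) (row i y)) ⟩
    ι (row i x ℤ.+ row i y)               ∎)
    where open ≡-Reasoning

  row-⊡ : ∀ i c x → row i (c ⊡ x) ≡ c ℤ.* row i x
  row-⊡ i c x = ι-injective (begin
    ι (row i (c ⊡ x))                     ≡⟨ row-≡ i (c ⊡ x) ⟩
    ι q Q.* F i (c ⊡ x)                   ≡⟨ cong (ι q Q.*_) (F-⊡ i c x) ⟩
    ι q Q.* (ι c Q.* F i x)               ≡⟨ sym (Qₚ.*-assoc (ι q) (ι c) (F i x)) ⟩
    ι q Q.* ι c Q.* F i x                 ≡⟨ cong (Q._* F i x) (Qₚ.*-comm (ι q) (ι c)) ⟩
    ι c Q.* ι q Q.* F i x                 ≡⟨ Qₚ.*-assoc (ι c) (ι q) (F i x) ⟩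
    ι c Q.* (ι q Q.* F i x)               ≡⟨ cong (ι c Q.*_) (sym (row-≡ i x)) ⟩
    ι c Q.* ι (row i x)                   ≡⟨ sym (ι-* c (row i x)) ⟩
    ι (c ℤ.* row i x)                     ∎)
    where open ≡-Reasoning

  cleared : Map D E
  cleared = record
    { app   = λ x → tabulate (λ i → row i x)
    ; app-⊞ = λ x y → lookup-ext λ i → trans (Vecₚ.lookup∘tabulate _ i) (trans (row-⊞ i x y)
        (sym (trans (lookup-⊞ (tabulate (λ i → row i x)) _ i) (cong₂ ℤ._+_ (Vecₚ.lookup∘tabulate _ i) (Vecₚ.lookup∘tabulate _ i)))))
    ; app-⊡ = λ c x → lookup-ext λ i → trans (Vecₚ.lookup∘tabulate _ i) (trans (row-⊡ i c x)
        (sym (trans (lookup-⊡ c (tabulate (λ i → row i x)) i) (cong (c ℤ.*_) (Vecₚ.lookup∘tabulate _ i)))))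
    }

  cleared-≡ : ∀ x i → ι (lookup (app cleared x) i) ≡ ι q Q.* F i x
  cleared-≡ x i = trans (cong ι (Vecₚ.lookup∘tabulate (λ i → row i x) i)) (row-≡ i x)

abstract
  clear-denominators : ∀ {D E} (F : Fin E → Vec ℤ D → ℚ) → (∀ i x y → F i (x ⊞ y) ≡ F i x Q.+ F i y) →
    (∀ i c x → F i (c ⊡ x) ≡ ι c Q.* F i x) →
    ∃₂ λ q (K : Map D E) → q ≢ 0ℤ × ∀ x i → ι (lookup (app K x) i) ≡ ι q Q.* F i x
  clear-denominators F F-⊞ F-⊡ = q , cleared , proj₁ (proj₂ denominators) , cleared-≡
    where open Clearing F F-⊞ F-⊡

-- Arithmetic and sums of Gaussian rationals

infixr 7 _∙_
_∙_ : ℚ → ℚi → ℚi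
r ∙ z = (r Q.* re z) +i (r Q.* im z)

∙-assoc : ∀ r s z → r ∙ s ∙ z ≡ (r Q.* s) ∙ z
∙-assoc r s z = cong₂ _+i_ (sym (Qₚ.*-assoc r s _)) (sym (Qₚ.*-assoc r s _))

∙-distrib : ∀ r w z → r ∙ (w +ᶜ z) ≡ (r ∙ w) +ᶜ (r ∙ z)
∙-distrib r w z = cong₂ _+i_ (Qₚ.*-distribˡ-+ r _ _) (Qₚ.*-distribˡ-+ r _ _)

∙-zero : ∀ r → r ∙ 0ᶜ ≡ 0ᶜ
∙-zero r = cong₂ _+i_ (Qₚ.*-zeroʳ r) (Qₚ.*-zeroʳ r)

module _ where
  open +-*-Solver

  ∙-*ʳ : ∀ r w z → w *ᶜ (r ∙ z) ≡ r ∙ (w *ᶜ z)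
  ∙-*ʳ r (a +i b) (c +i d) = cong₂ _+i_
    (solve 5 (λ r a b c d → a :* (r :* c) :- b :* (r :* d) := r :* (a :* c :- b :* d)) refl r a b c d)
    (solve 5 (λ r a b c d → a :* (r :* d) :+ b :* (r :* c) := r :* (a :* d :+ b :* c)) refl r a b c d)

  ∙-*ˡ : ∀ r w z → (r ∙ w) *ᶜ z ≡ r ∙ (w *ᶜ z)
  ∙-*ˡ r (a +i b) (c +i d) = cong₂ _+i_
    (solve 5 (λ r a b c d → (r :* a) :* c :- (r :* b) :* d := r :* (a :* c :- b :* d)) refl r a b c d)
    (solve 5 (λ r a b c d → (r :* a) :* d :+ (r :* b) :* c := r :* (a :* d :+ b :* c)) refl r a b c d)

  *ᶜ-distribˡ : ∀ u w z → u *ᶜ (w +ᶜ z) ≡ (u *ᶜ w) +ᶜ (u *ᶜ z)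
  *ᶜ-distribˡ (a +i b) (c +i d) (e +i f) = cong₂ _+i_
    (solve 6 (λ a b c d e f → a :* (c :+ e) :- b :* (d :+ f) := (a :* c :- b :* d) :+ (a :* e :- b :* f)) refl a b c d e f)
    (solve 6 (λ a b c d e f → a :* (d :+ f) :+ b :* (c :+ e) := (a :* d :+ b :* c) :+ (a :* f :+ b :* e)) refl a b c d e f)

  *ᶜ-comm : ∀ w z → w *ᶜ z ≡ z *ᶜ w
  *ᶜ-comm (a +i b) (c +i d) = cong₂ _+i_
    (solve 4 (λ a b c d → a :* c :- b :* d := c :* a :- d :* b) refl a b c d)
    (solve 4 (λ a b c d → a :* d :+ b :* c := c :* b :+ d :* a) refl a b c d)

  *ᶜ-assoc : ∀ u w z → (u *ᶜ w) *ᶜ z ≡ u *ᶜ (w *ᶜ z)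
  *ᶜ-assoc (a +i b) (c +i d) (e +i f) = cong₂ _+i_
    (solve 6 (λ a b c d e f → (a :* c :- b :* d) :* e :- (a :* d :+ b :* c) :* f
                            := a :* (c :* e :- d :* f) :- b :* (c :* f :+ d :* e)) refl a b c d e f)
    (solve 6 (λ a b c d e f → (a :* c :- b :* d) :* f :+ (a :* d :+ b :* c) :* e
                            := a :* (c :* f :+ d :* e) :+ b :* (c :* e :- d :* f)) refl a b c d e f)

  +ᶜ-interchange : ∀ u v w z → (u +ᶜ v) +ᶜ (w +ᶜ z) ≡ (u +ᶜ w) +ᶜ (v +ᶜ z)
  +ᶜ-interchange (a +i a′) (b +i b′) (c +i c′) (d +i d′) = cong₂ _+i_ (alg a b c d) (alg a′ b′ c′ d′)
    where
    alg : ∀ a b c d → (a Q.+ b) Q.+ (c Q.+ d) ≡ (a Q.+ c) Q.+ (b Q.+ d)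
    alg = solve 4 (λ a b c d → (a :+ b) :+ (c :+ d) := (a :+ c) :+ (b :+ d)) refl

  *ᶜ-zeroʳ : ∀ z → z *ᶜ 0ᶜ ≡ 0ᶜ
  *ᶜ-zeroʳ (a +i b) = cong₂ _+i_
    (solve 2 (λ a b → a :* con 0ℚ :- b :* con 0ℚ := con 0ℚ) refl a b)
    (solve 2 (λ a b → a :* con 0ℚ :+ b :* con 0ℚ := con 0ℚ) refl a b)

  *ᶜ-identityʳ : ∀ z → z *ᶜ 1ᶜ ≡ z
  *ᶜ-identityʳ (a +i b) = cong₂ _+i_
    (solve 2 (λ a b → a :* con 1ℚ :- b :* con 0ℚ := a) refl a b)
    (solve 2 (λ a b → a :* con 0ℚ :+ b :* con 1ℚ := b) refl a b)

+ᶜ-identityˡ : ∀ z → 0ᶜ +ᶜ z ≡ z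
+ᶜ-identityˡ z = cong₂ _+i_ (Qₚ.+-identityˡ _) (Qₚ.+-identityˡ _)

+ᶜ-identityʳ : ∀ z → z +ᶜ 0ᶜ ≡ z
+ᶜ-identityʳ z = cong₂ _+i_ (Qₚ.+-identityʳ _) (Qₚ.+-identityʳ _)

*ᶜ-distribʳ : ∀ u w z → (w +ᶜ z) *ᶜ u ≡ (w *ᶜ u) +ᶜ (z *ᶜ u)
*ᶜ-distribʳ u w z = trans (*ᶜ-comm (w +ᶜ z) u) (trans (*ᶜ-distribˡ u w z) (cong₂ _+ᶜ_ (*ᶜ-comm u w) (*ᶜ-comm u z)))

∑-cong : {f g : Vector d} → (∀ i → f i ≡ g i) → ∑ f ≡ ∑ g
∑-cong {zero}  eq = refl
∑-cong {suc d} eq = cong₂ _+ᶜ_ (eq zero) (∑-cong (eq ∘ suc))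

∑-+ : (f g : Vector d) → ∑ (λ i → f i +ᶜ g i) ≡ ∑ f +ᶜ ∑ g
∑-+ {zero}  f g = sym (+ᶜ-identityˡ 0ᶜ)
∑-+ {suc d} f g = trans (cong ((f zero +ᶜ g zero) +ᶜ_) (∑-+ (f ∘ suc) (g ∘ suc))) (+ᶜ-interchange (f zero) (g zero) (∑ (f ∘ suc)) (∑ (g ∘ suc)))

∑-∙ : ∀ r (f : Vector d) → ∑ (λ i → r ∙ f i) ≡ r ∙ ∑ f
∑-∙ {zero}  r f = sym (∙-zero r)
∑-∙ {suc d} r f = trans (cong ((r ∙ f zero) +ᶜ_) (∑-∙ r (f ∘ suc))) (sym (∙-distrib r (f zero) (∑ (f ∘ suc))))

∑-*ˡ : ∀ u (f : Vector d) → u *ᶜ ∑ f ≡ ∑ (λ i → u *ᶜ f i)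
∑-*ˡ {zero}  u f = *ᶜ-zeroʳ u
∑-*ˡ {suc d} u f = trans (*ᶜ-distribˡ u (f zero) (∑ (f ∘ suc))) (cong ((u *ᶜ f zero) +ᶜ_) (∑-*ˡ u (f ∘ suc)))

∑-zero : ∑ {d} (λ _ → 0ᶜ) ≡ 0ᶜ
∑-zero {zero}  = refl
∑-zero {suc d} = trans (+ᶜ-identityˡ _) (∑-zero {d})

∑-swap : ∀ {m} (f : Fin d → Fin m → ℚi) → ∑ (λ i → ∑ (f i)) ≡ ∑ (λ j → ∑ (λ i → f i j))
∑-swap {zero}  {m} f = sym (∑-zero {m})
∑-swap {suc d} f = trans (cong (∑ (f zero) +ᶜ_) (∑-swap (f ∘ suc))) (sym (∑-+ (f zero) (λ j → ∑ (λ i → f (suc i) j))))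

∑-𝕀 : ∀ (f : Vector d) j → ∑ (λ k → f k *ᶜ 𝕀 k j) ≡ f j
∑-𝕀 {suc d} f zero    = trans (cong₂ _+ᶜ_ (*ᶜ-identityʳ (f zero))
  (trans (∑-cong {d} (λ k → *ᶜ-zeroʳ (f (suc k)))) (∑-zero {d}))) (+ᶜ-identityʳ _)
∑-𝕀 {suc d} f (suc j) = trans (cong₂ _+ᶜ_ (*ᶜ-zeroʳ (f zero)) (∑-𝕀 (f ∘ suc) j)) (+ᶜ-identityˡ _)

-- Linear operators on matrices

infixr 7 _⊙_
_⊙_ : ℚ → Matrix d → Matrix d
(r ⊙ A) i j = r ∙ A i j

-- Linearity is over ℚ, matching the coordinates by real and imaginary parts. Congruence is a field
-- because matrices are functions compared entrywise.
record IsLinear (𝓕 : Matrix d → Matrix d) : Set where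
  field
    ≐-cong : ∀ {A B} → A ≐ B → 𝓕 A ≐ 𝓕 B
    ⊕-homo : ∀ A B → 𝓕 (A ⊕ B) ≐ (𝓕 A ⊕ 𝓕 B)
    ⊙-homo : ∀ r A → 𝓕 (r ⊙ A) ≐ (r ⊙ 𝓕 A)
open IsLinear

·-linearˡ : (E : Matrix d) → IsLinear (E ·_)
·-linearˡ E = record
  { ≐-cong = λ eq i j → ∑-cong (λ k → cong (E i k *ᶜ_) (eq k j))
  ; ⊕-homo = λ A B i j → trans (∑-cong (λ k → *ᶜ-distribˡ (E i k) (A k j) (B k j)))
                               (∑-+ (λ k → E i k *ᶜ A k j) (λ k → E i k *ᶜ B k j))
  ; ⊙-homo = λ r A i j → trans (∑-cong (λ k → ∙-*ʳ r (E i k) (A k j))) (∑-∙ r (λ k → E i k *ᶜ A k j))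
  }

·-linearʳ : (E : Matrix d) → IsLinear (_· E)
·-linearʳ E = record
  { ≐-cong = λ eq i j → ∑-cong (λ k → cong (_*ᶜ E k j) (eq i k))
  ; ⊕-homo = λ A B i j → trans (∑-cong (λ k → *ᶜ-distribʳ (E k j) (A i k) (B i k)))
                               (∑-+ (λ k → A i k *ᶜ E k j) (λ k → B i k *ᶜ E k j))
  ; ⊙-homo = λ r A i j → trans (∑-cong (λ k → ∙-*ˡ r (A i k) (E k j))) (∑-∙ r (λ k → A i k *ᶜ E k j))
  }

∘-linear : {𝓕 𝓖 : Matrix d → Matrix d} → IsLinear 𝓕 → IsLinear 𝓖 → IsLinear (𝓕 ∘ 𝓖)
∘-linear {𝓕 = 𝓕} {𝓖} F G = record
  { ≐-cong = ≐-cong F ∘ ≐-cong G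
  ; ⊕-homo = λ A B i j → trans (≐-cong F (⊕-homo G A B) i j) (⊕-homo F (𝓖 A) (𝓖 B) i j)
  ; ⊙-homo = λ r A i j → trans (≐-cong F (⊙-homo G r A) i j) (⊙-homo F r (𝓖 A) i j)
  }

⊕-linear : {𝓕 𝓖 : Matrix d → Matrix d} → IsLinear 𝓕 → IsLinear 𝓖 → IsLinear (λ A → 𝓕 A ⊕ 𝓖 A)
⊕-linear {𝓕 = 𝓕} {𝓖} F G = record
  { ≐-cong = λ eq i j → cong₂ _+ᶜ_ (≐-cong F eq i j) (≐-cong G eq i j)
  ; ⊕-homo = λ A B i j → trans (cong₂ _+ᶜ_ (⊕-homo F A B i j) (⊕-homo G A B i j))
                               (+ᶜ-interchange (𝓕 A i j) (𝓕 B i j) (𝓖 A i j) (𝓖 B i j))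
  ; ⊙-homo = λ r A i j → trans (cong₂ _+ᶜ_ (⊙-homo F r A i j) (⊙-homo G r A i j)) (sym (∙-distrib r (𝓕 A i j) (𝓖 A i j)))
  }

𝟘-linear : IsLinear {d} (λ _ → 𝟘)
𝟘-linear = record
  { ≐-cong = λ _ _ _ → refl
  ; ⊕-homo = λ _ _ _ _ → sym (+ᶜ-identityˡ 0ᶜ)
  ; ⊙-homo = λ r _ _ _ → sym (∙-zero r)
  }

⊙-linear : ∀ r → IsLinear {d} (r ⊙_)
⊙-linear r = record
  { ≐-cong = λ eq i j → cong (r ∙_) (eq i j)
  ; ⊕-homo = λ A B i j → ∙-distrib r (A i j) (B i j)
  ; ⊙-homo = λ s A i j → trans (∙-assoc r s (A i j)) (trans (cong (_∙ A i j) (Qₚ.*-comm r s)) (sym (∙-assoc s r (A i j))))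
  }

apply-linear : (Es : Kraus d) → IsLinear (apply Es)
apply-linear []       = 𝟘-linear
apply-linear (E ∷ Es) = ⊕-linear (∘-linear (·-linearʳ (E †)) (·-linearˡ E)) (apply-linear Es)

part : Fin 2 → ℚi → ℚ
part zero    = re
part (suc _) = im

part-+ : ∀ b w z → part b (w +ᶜ z) ≡ part b w Q.+ part b z
part-+ zero    w z = refl
part-+ (suc _) w z = refl

part-∙ : ∀ b r z → part b (r ∙ z) ≡ r Q.* part b z
part-∙ zero    r z = refl
part-∙ (suc _) r z = refl

part-ext : ∀ {w z} → (∀ b → part b w ≡ part b z) → w ≡ z
part-ext eq = cong₂ _+i_ (eq zero) (eq (suc zero))

part-0 : ∀ b → part b 0ᶜ ≡ 0ℚ
part-0 zero    = refl
part-0 (suc _) = refl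

-- Integer coordinates of matrices

module Encoding (d : ℕ) where

  dim : ℕ
  dim = d ℕ.* (d ℕ.* 2)

  index : Fin d → Fin d → Fin 2 → Fin dim
  index i j b = combine i (combine j b)

  position : Fin dim → Fin d × Fin d × Fin 2
  position k = proj₁ (remQuot {d} (d ℕ.* 2) k) , remQuot {d} 2 (proj₂ (remQuot {d} (d ℕ.* 2) k))

  position-index : ∀ (i j : Fin d) b → position (index i j b) ≡ (i , j , b)
  position-index i j b = trans
    (cong (λ h → proj₁ h , remQuot {d} 2 (proj₂ h)) (Finₚ.remQuot-combine {d} {d ℕ.* 2} i (combine j b)))
    (cong (i ,_) (Finₚ.remQuot-combine {d} {2} j b))

  component : Fin d × Fin d × Fin 2 → Matrix d → ℚ
  component (i , j , b) A = part b (A i j)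

  entry : Fin dim → Matrix d → ℚ
  entry k = component (position k)

  entry-index : ∀ (i j : Fin d) b A → entry (index i j b) A ≡ part b (A i j)
  entry-index i j b A = cong (λ h → component h A) (position-index i j b)

  entry-≐ : ∀ (k : Fin dim) {A B : Matrix d} → A ≐ B → entry k A ≡ entry k B
  entry-≐ k {A} {B} eq = at (position k)
    where
    at : ∀ h → component h A ≡ component h B
    at (i , j , b) = cong (part b) (eq i j)

  entry-⊕ : ∀ (k : Fin dim) (A B : Matrix d) → entry k (A ⊕ B) ≡ entry k A Q.+ entry k B
  entry-⊕ k A B = at (position k)
    where
    at : ∀ h → component h (A ⊕ B) ≡ component h A Q.+ component h B
    at (i , j , b) = part-+ b (A i j) (B i j)

  entry-⊙ : ∀ (k : Fin dim) r (A : Matrix d) → entry k (r ⊙ A) ≡ r Q.* entry k A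
  entry-⊙ k r A = at (position k)
    where
    at : ∀ h → component h (r ⊙ A) ≡ r Q.* component h A
    at (i , j , b) = part-∙ b r (A i j)

  decode : Vec ℤ dim → Matrix d
  decode x i j = ι (lookup x (index i j zero)) +i ι (lookup x (index i j (suc zero)))

  part-decode : ∀ b (x : Vec ℤ dim) i j → part b (decode x i j) ≡ ι (lookup x (index i j b))
  part-decode zero       x i j = refl
  part-decode (suc zero) x i j = refl

  decode-⊞ : ∀ (x y : Vec ℤ dim) → decode (x ⊞ y) ≐ (decode x ⊕ decode y)
  decode-⊞ x y i j = cong₂ _+i_ (at (index i j zero)) (at (index i j (suc zero)))
    where
    at : ∀ k → ι (lookup (x ⊞ y) k) ≡ ι (lookup x k) Q.+ ι (lookup y k)
    at k = trans (cong ι (lookup-⊞ x y k)) (ι-+ (lookup x k) (lookup y k))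

  decode-⊡ : ∀ c (x : Vec ℤ dim) → decode (c ⊡ x) ≐ (ι c ⊙ decode x)
  decode-⊡ c x i j = cong₂ _+i_ (at (index i j zero)) (at (index i j (suc zero)))
    where
    at : ∀ k → ι (lookup (c ⊡ x) k) ≡ ι c Q.* ι (lookup x k)
    at k = trans (cong ι (lookup-⊡ c x k)) (ι-* c (lookup x k))

  decode-entries : ∀ (x : Vec ℤ dim) r A → (∀ k → ι (lookup x k) ≡ r Q.* entry k A) → decode x ≐ (r ⊙ A)
  decode-entries x r A eq i j = part-ext λ b → begin
    part b (decode x i j)          ≡⟨ part-decode b x i j ⟩
    ι (lookup x (index i j b))     ≡⟨ eq (index i j b) ⟩
    r Q.* entry (index i j b) A    ≡⟨ cong (r Q.*_) (entry-index i j b A) ⟩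
    r Q.* part b (A i j)           ≡⟨ sym (part-∙ b r (A i j)) ⟩
    part b (r ∙ A i j)             ∎
    where open ≡-Reasoning

  -- States are represented projectively: subspaces do not see a nonzero scale, so every map may
  -- clear its own denominators.
  record _represents_ (x : Vec ℤ dim) (σ : Matrix d) : Set where
    constructor scaled
    field
      scale   : ℤ
      scale≢0 : scale ≢ 0ℤ
      decode≐ : decode x ≐ (ι scale ⊙ σ)

  abstract
    representative : (σ : Matrix d) → ∃ λ x → x represents σ
    representative σ with c , c≢0 , h ← common-denominator dim (λ k → entry k σ) =
      tabulate (proj₁ ∘ h) , scaled c c≢0 (decode-entries (tabulate (proj₁ ∘ h)) (ι c) σ
        (λ k → trans (cong ι (Vecₚ.lookup∘tabulate (proj₁ ∘ h) k)) (proj₂ (h k))))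

  index-position : ∀ k → index (proj₁ (position k)) (proj₁ (proj₂ (position k))) (proj₂ (proj₂ (position k))) ≡ k
  index-position k = trans (cong (combine (proj₁ (position k))) (Finₚ.combine-remQuot {d} 2 (proj₂ (remQuot {d} (d ℕ.* 2) k))))
                           (Finₚ.combine-remQuot {d} (d ℕ.* 2) k)

  abstract
    -- One integer clears the denominators of the operator on all basis vectors at once; it
    -- multiplies the scale of whatever is represented.
    integral-map : {𝓕 : Matrix d → Matrix d} → IsLinear 𝓕 →
                   ∃ λ (K : Map dim dim) → ∀ {x σ} → x represents σ → app K x represents 𝓕 σ
    integral-map {𝓕} F = finish (clear-denominators (λ k x → entry k (𝓕 (decode x)))
        (λ k x y → trans (entry-≐ k (λ i j → trans (≐-cong F (decode-⊞ x y) i j) (⊕-homo F (decode x) (decode y) i j)))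
                         (entry-⊕ k (𝓕 (decode x)) (𝓕 (decode y))))
        (λ k c x → trans (entry-≐ k (λ i j → trans (≐-cong F (decode-⊡ c x) i j) (⊙-homo F (ι c) (decode x) i j)))
                         (entry-⊙ k (ι c) (𝓕 (decode x)))))
      where
      open ≡-Reasoning
      finish : (∃₂ λ q (K : Map dim dim) → q ≢ 0ℤ × ∀ x k → ι (lookup (app K x) k) ≡ ι q Q.* entry k (𝓕 (decode x))) →
               ∃ λ (K : Map dim dim) → ∀ {x σ} → x represents σ → app K x represents 𝓕 σ
      finish (q , K , q≢0 , K≡) = K , λ {x} {σ} (scaled c c≢0 x≡) → scaled (q ℤ.* c) (≢0-* q≢0 c≢0) λ i j → begin
        decode (app K x) i j        ≡⟨ decode-entries (app K x) (ι q) (𝓕 (decode x)) (K≡ x) i j ⟩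
        ι q ∙ 𝓕 (decode x) i j      ≡⟨ cong (ι q ∙_) (trans (≐-cong F x≡ i j) (⊙-homo F (ι c) σ i j)) ⟩
        ι q ∙ ι c ∙ 𝓕 σ i j         ≡⟨ ∙-assoc (ι q) (ι c) (𝓕 σ i j) ⟩
        (ι q Q.* ι c) ∙ 𝓕 σ i j     ≡⟨ cong (_∙ 𝓕 σ i j) (sym (ι-* q c)) ⟩
        ι (q ℤ.* c) ∙ 𝓕 σ i j       ∎

  Zero : Vec ℤ dim → Set
  Zero x = ∀ k → lookup x k ≡ 0ℤ

  zero⇒𝟘 : ∀ {x σ} → x represents σ → Zero x → σ ≐ 𝟘
  zero⇒𝟘 {x} {σ} (scaled c c≢0 x≡) x0 i j = part-ext λ b → trans (ι-cancel c≢0 (begin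
      ι c Q.* part b (σ i j)       ≡⟨ sym (part-∙ b (ι c) (σ i j)) ⟩
      part b (ι c ∙ σ i j)         ≡⟨ cong (part b) (sym (x≡ i j)) ⟩
      part b (decode x i j)        ≡⟨ part-decode b x i j ⟩
      ι (lookup x (index i j b))   ≡⟨ cong ι (x0 (index i j b)) ⟩
      0ℚ                           ∎)) (sym (part-0 b))
    where open ≡-Reasoning

  𝟘⇒zero : ∀ {x σ} → x represents σ → σ ≐ 𝟘 → Zero x
  𝟘⇒zero {x} {σ} (scaled c c≢0 x≡) σ0 k = trans (cong (lookup x) (sym (index-position k))) (at (position k))
    where
    open ≡-Reasoning
    at : ∀ h → lookup x (index (proj₁ h) (proj₁ (proj₂ h)) (proj₂ (proj₂ h))) ≡ 0ℤ
    at (i , j , b) = ι-injective (begin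
      ι (lookup x (index i j b))   ≡⟨ sym (part-decode b x i j) ⟩
      part b (decode x i j)        ≡⟨ cong (part b) (trans (x≡ i j) (trans (cong (ι c ∙_) (σ0 i j)) (∙-zero (ι c)))) ⟩
      part b 0ᶜ                    ≡⟨ part-0 b ⟩
      0ℚ                           ∎)

-- Satisfaction as a linear equation

⊨⇒≐ : ∀ {σ P : Matrix d} → σ ⊨ P → (P · σ) ≐ σ
-- Testing on the standard basis vectors, the columns of `𝕀`, recovers the matrix equation column by
-- column.
⊨⇒≐ {σ = σ} {P} sat i j = begin
  ∑ (λ k → P i k *ᶜ σ k j)                          ≡⟨ ∑-cong (λ k → cong (P i k *ᶜ_) (sym (∑-𝕀 (σ k) j))) ⟩
  ∑ (λ k → P i k *ᶜ (σ ▷ (λ l → 𝕀 l j)) k)          ≡⟨ sat (λ l → 𝕀 l j) i ⟩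
  (σ ▷ (λ l → 𝕀 l j)) i                             ≡⟨ ∑-𝕀 (σ i) j ⟩
  σ i j                                             ∎
  where open ≡-Reasoning

≐⇒⊨ : ∀ {σ P : Matrix d} → (P · σ) ≐ σ → σ ⊨ P
≐⇒⊨ {σ = σ} {P} eq x i = begin
  ∑ (λ k → P i k *ᶜ ∑ (λ l → σ k l *ᶜ x l))         ≡⟨ ∑-cong (λ k → ∑-*ˡ (P i k) (λ l → σ k l *ᶜ x l)) ⟩
  ∑ (λ k → ∑ (λ l → P i k *ᶜ (σ k l *ᶜ x l)))       ≡⟨ ∑-swap (λ k l → P i k *ᶜ (σ k l *ᶜ x l)) ⟩
  ∑ (λ l → ∑ (λ k → P i k *ᶜ (σ k l *ᶜ x l)))       ≡⟨ ∑-cong column ⟩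
  ∑ (λ l → σ i l *ᶜ x l)                            ∎
  where
  open ≡-Reasoning
  column : ∀ l → ∑ (λ k → P i k *ᶜ (σ k l *ᶜ x l)) ≡ σ i l *ᶜ x l
  column l = begin
    ∑ (λ k → P i k *ᶜ (σ k l *ᶜ x l))    ≡⟨ ∑-cong (λ k → trans (sym (*ᶜ-assoc (P i k) (σ k l) (x l))) (*ᶜ-comm (P i k *ᶜ σ k l) (x l))) ⟩
    ∑ (λ k → x l *ᶜ (P i k *ᶜ σ k l))    ≡⟨ sym (∑-*ˡ (x l) (λ k → P i k *ᶜ σ k l)) ⟩
    x l *ᶜ (P · σ) i l                   ≡⟨ cong (x l *ᶜ_) (eq i l) ⟩
    x l *ᶜ σ i l                         ≡⟨ *ᶜ-comm (x l) (σ i l) ⟩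
    σ i l *ᶜ x l                         ∎

-- The difference is written with the scalar -1 so that its linearity follows from the closure
-- properties of `IsLinear`.
defect : Matrix d → Matrix d → Matrix d
defect P σ = (P · σ) ⊕ ((Q.- 1ℚ) ⊙ σ)

defect-linear : (P : Matrix d) → IsLinear (defect P)
defect-linear P = ⊕-linear (·-linearˡ P) (⊙-linear (Q.- 1ℚ))

defect-zero : ∀ w z → w +ᶜ ((Q.- 1ℚ) ∙ z) ≡ 0ᶜ → w ≡ z
defect-zero w z eq = cong₂ _+i_ (at (re w) (re z) (cong re eq)) (at (im w) (im z) (cong im eq))
  where
  open +-*-Solver
  at : ∀ a b → a Q.+ (Q.- 1ℚ) Q.* b ≡ 0ℚ → a ≡ b
  at a b eq = trans (solve 2 (λ a b → a := (a :+ (:- con 1ℚ) :* b) :+ b) refl a b)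
                    (trans (cong (Q._+ b) eq) (Qₚ.+-identityˡ b))

zero-defect : ∀ z → z +ᶜ ((Q.- 1ℚ) ∙ z) ≡ 0ᶜ
zero-defect z = cong₂ _+i_ (at (re z)) (at (im z))
  where
  open +-*-Solver
  at : ∀ a → a Q.+ (Q.- 1ℚ) Q.* a ≡ 0ℚ
  at = solve 1 (λ a → a :+ (:- con 1ℚ) :* a := con 0ℚ) refl

-- Reduction of the automaton to an integer linear system

module _ {d n t : ℕ} (A : QAutomaton d (suc n)) (ps : Fin t → Matrix d) where

  open Encoding d

  operation : Fin (suc n) → Map dim dim
  operation α = proj₁ (integral-map (apply-linear (ops A α)))

  constraint : Fin t → Map dim dim
  constraint i = proj₁ (integral-map (defect-linear (ps i)))

  constraints : Fin t → List (Functional dim)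
  constraints i = List.tabulate (λ k → coordinate k ∘ᶠ constraint i)

  open Linear operation constraints

  initial : Vec ℤ dim
  initial = proj₁ (representative (σ₀ A))

  run-represented : ∀ w i → app (act w i) initial represents run A w i
  run-represented w zero    = proj₂ (representative (σ₀ A))
  run-represented w (suc i) = proj₂ (integral-map (apply-linear (ops A (w i)))) (run-represented w i)

  hit⇒⊨ : ∀ {x σ} → x represents σ → Hit x → σ ⊨∨ ps
  hit⇒⊨ {x} {σ} rep (i , ks) = i , ≐⇒⊨ {σ = σ} {ps i} λ a b → defect-zero ((ps i · σ) a b) (σ a b)
    (zero⇒𝟘 (proj₂ (integral-map (defect-linear (ps i))) rep) (Allₚ.tabulate⁻ ks) a b)

  ⊨⇒hit : ∀ {x σ} → x represents σ → σ ⊨∨ ps → Hit x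
  ⊨⇒hit {x} {σ} rep (i , sat) = i , Allₚ.tabulate⁺
    (𝟘⇒zero (proj₂ (integral-map (defect-linear (ps i))) rep) λ a b →
      trans (cong (_+ᶜ ((Q.- 1ℚ) ∙ σ a b)) (⊨⇒≐ {σ = σ} {ps i} sat a b)) (zero-defect (σ a b)))

  valid⇒always-eventually : Valid initial → ValidAlwaysEventually A ps
  valid⇒always-eventually val w N = visit (val w N)
    where
    visit : (∃ λ i → N ℕ.≤ i × Hit (app (act w i) initial)) → ∃ λ i → N ℕ.≤ i × (run A w i ⊨∨ ps)
    visit (i , N≤i , hit) = i , N≤i , hit⇒⊨ (run-represented w i) hit

  always-eventually⇒valid : ValidAlwaysEventually A ps → Valid initial
  always-eventually⇒valid val w N = visit (val w N)
    where
    visit : (∃ λ i → N ℕ.≤ i × (run A w i ⊨∨ ps)) → ∃ λ i → N ℕ.≤ i × Hit (app (act w i) initial)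
    visit (i , N≤i , sat) = i , N≤i , ⊨⇒hit (run-represented w i) sat

  valid-always-eventually? : Dec (ValidAlwaysEventually A ps)
  valid-always-eventually? = Dec.map′ valid⇒always-eventually always-eventually⇒valid (valid? initial)

theorem11 : (d n t : ℕ) (A : QAutomaton d n) (ps : Fin t → Matrix d) →
    (∀ i → IsProjection (ps i)) →
    Dec (ValidAlwaysEventually A ps)
-- Without actions there are no infinite words, and validity is vacuous.
theorem11 d zero    t A ps _ = yes λ w → contradiction (w 0) λ ()
theorem11 d (suc n) t A ps _ = valid-always-eventually? A ps
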